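{- Let $n,k$ be positive integers with $k\leq n$, and write $n=kq+r$ with integers $q,r$ and $0\leq r<k$. Let $G$ be a graph on $n$ vertices with exactly $k$ connected components. Then $$F(G)\geq r(q+1)+\frac{kq(q+1)}{2},$$ with equality if and only if $G$ is isomorphic to $rP_{q+1}\cup (k-r)P_q$.
   Context: All graphs are finite, simple and undirected. A connected subgraph of a graph $G=(V,E)$ is a graph $(V',E')$ with $\emptyset\neq V'\subseteq V$, $E'\subseteq E$, every edge of $E'$ having both endpoints in $V'$, and $(V',E')$ connected; distinct pairs $(V',E')$ are counted separately. The core index $F(G)$ is the number of connected subgraphs of $G$ (for a disconnected graph it is the sum over its components). $P_m$ is the path on $m$ vertices, $\cup$ denotes disjoint union and $mG$ the disjoint union of $m$ copies of $G$. -}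

module Defs where

open import Data.Bool using (Bool; true; false; _∧_; _∨_; not; _xor_; if_then_else_)
open import Data.Bool.Properties using (∨-comm)
open import Data.Nat using (ℕ; zero; suc; _+_; _*_; _≡ᵇ_; _<ᵇ_)
open import Data.Fin using (Fin; toℕ; splitAt; _≟_)
open import Data.Sum using (_⊎_; inj₁; inj₂)
open import Data.Product using (_×_; _,_)
open import Data.List using (List; []; _∷_; [_]; _++_; map; concatMap; length; null; filterᵇ; allFin)
open import Data.Bool.ListAction using (all; any)
open import Relation.Binary.PropositionalEquality using (_≡_; refl)
open import Relation.Nullary.Decidable using (does)
open import Function.Bundles using (_↔_; Inverse)

record Graph (n : ℕ) : Set where
  field
    adj    : Fin n → Fin n → Bool
    sym    : ∀ i j → adj i j ≡ adj j i
    irrefl : ∀ i → adj i i ≡ false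
open Graph public

record _≅_ {n m : ℕ} (G : Graph n) (H : Graph m) : Set where
  field
    bij      : Fin n ↔ Fin m
    preserve : ∀ i j → adj G i j ≡ adj H (Inverse.to bij i) (Inverse.to bij j)

private
  suc≢ᵇ : ∀ x → (suc x ≡ᵇ x) ≡ false
  suc≢ᵇ zero    = refl
  suc≢ᵇ (suc x) = suc≢ᵇ x

  or-false : ∀ {a} → a ≡ false → (a ∨ a) ≡ false
  or-false refl = refl

P : (m : ℕ) → Graph m
P m = record
  { adj    = λ i j → (suc (toℕ i) ≡ᵇ toℕ j) ∨ (suc (toℕ j) ≡ᵇ toℕ i)
  ; sym    = λ i j → ∨-comm (suc (toℕ i) ≡ᵇ toℕ j) (suc (toℕ j) ≡ᵇ toℕ i)
  ; irrefl = λ i → or-false (suc≢ᵇ (toℕ i))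
  }

empty : Graph 0
empty = record { adj = λ () ; sym = λ () ; irrefl = λ () }

unionAdj : ∀ {m n} → Graph m → Graph n → Fin m ⊎ Fin n → Fin m ⊎ Fin n → Bool
unionAdj G H (inj₁ a) (inj₁ b) = adj G a b
unionAdj G H (inj₂ a) (inj₂ b) = adj H a b
unionAdj G H (inj₁ a) (inj₂ b) = false
unionAdj G H (inj₂ a) (inj₁ b) = false

unionSym : ∀ {m n} (G : Graph m) (H : Graph n) x y → unionAdj G H x y ≡ unionAdj G H y x
unionSym G H (inj₁ a) (inj₁ b) = sym G a b
unionSym G H (inj₂ a) (inj₂ b) = sym H a b
unionSym G H (inj₁ a) (inj₂ b) = refl
unionSym G H (inj₂ a) (inj₁ b) = refl

unionIrr : ∀ {m n} (G : Graph m) (H : Graph n) x → unionAdj G H x x ≡ false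
unionIrr G H (inj₁ a) = irrefl G a
unionIrr G H (inj₂ a) = irrefl H a

_∪_ : ∀ {m n} → Graph m → Graph n → Graph (m + n)
_∪_ {m} G H = record
  { adj    = λ i j → unionAdj G H (splitAt m i) (splitAt m j)
  ; sym    = λ i j → unionSym G H (splitAt m i) (splitAt m j)
  ; irrefl = λ i → unionIrr G H (splitAt m i)
  }

copies : ∀ {m} (c : ℕ) → Graph m → Graph (c * m)
copies zero    G = empty
copies (suc c) G = G ∪ copies c G

-- Subsets as sublists (of an enumeration without repetitions)

sublists : ∀ {A : Set} → List A → List (List A)
sublists []       = [ [] ]
sublists (x ∷ xs) = let s = sublists xs in map (x ∷_) s ++ s

count : ∀ {A : Set} → (A → Bool) → List A → ℕ
count p xs = length (filterᵇ p xs)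

module _ {n : ℕ} where

  _∈ᵇ_ : Fin n → List (Fin n) → Bool
  v ∈ᵇ S = any (λ u → does (u ≟ v)) S

  Edge : Set
  Edge = Fin n × Fin n

  edges : Graph n → List Edge
  edges G = concatMap (λ i → concatMap (λ j →
              if adj G i j ∧ (toℕ i <ᵇ toℕ j) then [ (i , j) ] else [])
              (allFin n)) (allFin n)

  crosses : List Edge → List (Fin n) → Bool
  crosses E S = any (λ { (u , v) → (u ∈ᵇ S) xor (v ∈ᵇ S) }) E

  -- (V , E) is connected: V nonempty and V admits no separation, i.e. every
  -- nonempty proper subset S of V has an edge of E leaving it
  connected : List (Fin n) → List Edge → Bool
  connected V E = not (null V) ∧
    all (λ S → null S ∨ (length S ≡ᵇ length V) ∨ crosses E S) (sublists V)

  -- (V , E) is a connected subgraph of G (E ⊆ edges G by construction)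
  isConnSub : List (Fin n) → List Edge → Bool
  isConnSub V E = all (λ { (u , v) → (u ∈ᵇ V) ∧ (v ∈ᵇ V) }) E ∧ connected V E

  F : Graph n → ℕ
  F G = length (concatMap (λ V → filterᵇ (isConnSub V) (sublists (edges G)))
                          (sublists (allFin n)))

  induced : Graph n → List (Fin n) → List Edge
  induced G S = filterᵇ (λ { (u , v) → (u ∈ᵇ S) ∧ (v ∈ᵇ S) }) (edges G)

  isComponent : Graph n → List (Fin n) → Bool
  isComponent G S = connected S (induced G S) ∧ not (crosses (edges G) S)

  numComponents : Graph n → ℕ
  numComponents G = count (isComponent G) (sublists (allFin n))

{-# OPTIONS --safe #-}
module Submission where

-- Send a pair {u , v} of vertices of one component (u = v allowed) to the
-- subgraph induced on a geodesic from u to v.  The endpoints are recovered as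
-- the two vertices at maximal distance, so F(G) is at least the sum of
-- m(m+1)/2 over the component sizes m, and convexity of m(m+1)/2 gives the
-- bound.  In the case of equality every connected subgraph arises in this way;
-- in particular each component is itself a geodesic, that is, an induced path,
-- and the sizes are balanced.  Conversely, number the vertices of a linear
-- forest along its paths: a connected subgraph is determined by its smallest
-- and largest numbers, so there are no more subgraphs than intervals.

open import Defs
open import Data.Bool using (Bool; true; false; T; not; _∧_; _∨_; _xor_; if_then_else_)
open import Data.Bool.Properties using (T-∧; T-∨; T-≡; T?) renaming (_≟_ to _≟ᵇ_)
open import Data.Empty using (⊥; ⊥-elim)
open import Data.Fin as Fin using (Fin; toℕ; fromℕ<; splitAt; join; _↑ˡ_; _↑ʳ_)
open import Data.Fin.Properties as Finₚ using (toℕ-injective; toℕ<n; toℕ-fromℕ<; join-splitAt; splitAt-↑ˡ; splitAt-↑ʳ; toℕ-↑ˡ; toℕ-↑ʳ)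
open import Data.List using (List; []; _∷_; [_]; _++_; map; concatMap; length; null; filter; filterᵇ; allFin; upTo)
open import Data.List.Membership.DecPropositional using () renaming (_∈?_ to ∈-dec)
open import Data.List.Membership.Propositional using (_∈_; find; lose)
open import Data.List.Membership.Propositional.Properties using (∈-map⁺; ∈-map⁻; ∈-++⁺ˡ; ∈-++⁺ʳ; ∈-++⁻; ∈-concatMap⁺; ∈-concatMap⁻; ∈-filter⁺; ∈-filter⁻; ∈-allFin; ∈-∃++; ∈-upTo⁺; ∈-upTo⁻)
open import Data.List.Properties using (length-map; length-++; filter-complete; length-tabulate; filter-accept; filter-reject; map-∘; length-upTo)
open import Data.List.Relation.Binary.Permutation.Propositional using (_↭_; ↭-refl; ↭-trans)
open import Data.List.Relation.Binary.Permutation.Propositional.Properties using (∈-resp-↭; ↭-length; shift) renaming (++⁺ˡ to ↭-++⁺ˡ)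
open import Data.List.Relation.Binary.Pointwise using (Pointwise; []; _∷_; Pointwise-length)
open import Data.List.Relation.Binary.Sublist.Propositional using (_⊆_; []; _∷ʳ_; _∷_) renaming (lookup to ⊆-lookup)
open import Data.List.Relation.Binary.Sublist.Propositional.Properties using (filter-⊆; length-mono-≤)
open import Data.List.Relation.Unary.All as All using (All; []; _∷_)
open import Data.List.Relation.Unary.All.Properties using (all⁺; all⁻; ¬Any⇒All¬) renaming (anti-mono to All-anti-mono; map⁻ to All-map⁻)
open import Data.List.Relation.Unary.AllPairs using (AllPairs; []; _∷_)
open import Data.List.Relation.Unary.AllPairs.Properties using (tabulate⁺-<) renaming (filter⁺ to AllPairs-filter⁺)
open import Data.List.Relation.Unary.Any as Any using (Any; here; there)
open import Data.List.Relation.Unary.Any.Properties using (any⁺; any⁻)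
open import Data.List.Relation.Unary.Unique.Propositional using (Unique)
open import Data.List.Relation.Unary.Unique.Propositional.Properties using (Unique[x∷xs]⇒x∉xs; allFin⁺) renaming (map⁺ to Unique-map⁺; ++⁺ to Unique-++⁺; filter⁺ to Unique-filter⁺)
open import Data.Nat using (ℕ; zero; suc; _+_; _*_; _∸_; _/_; _≤_; _<_; z≤n; s≤s; _<ᵇ_; _≡ᵇ_; _≤ᵇ_)
open import Data.Nat.DivMod using (m*n/n≡m)
open import Data.Nat.Induction using (<-rec)
open import Data.Nat.ListAction using (sum)
open import Data.Nat.Properties
open import Data.Nat.Solver using (module +-*-Solver)
open import Data.Product using (_×_; _,_; proj₁; proj₂; ∃; ∃₂; Σ)
open import Data.Sum using (_⊎_; inj₁; inj₂; [_,_]′)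
open import Data.Unit using (tt)
open import Function using (_∘_; id)
open import Function.Bundles using (_⇔_; Equivalence; mk⇔; mk↔ₛ′; Inverse)
open import Relation.Binary.Definitions using (tri<; tri≈; tri>)
open import Relation.Binary.PropositionalEquality using (_≡_; _≢_; refl; trans; cong; cong₂; subst; subst₂; module ≡-Reasoning) renaming (sym to ≡-sym)
open import Relation.Nullary using (¬_; Dec; yes; no; does; contradiction)
open import Relation.Nullary.Decidable using (dec-true; _×-dec_; ¬?; map′)
open +-*-Solver using (solve; _:=_; _:+_; _:*_; con)

-- Geodesics are not unique and none is preferred, so the map from pairs to subgraphs is handled as
-- a relation, `Spans`, in which any geodesic may serve; the counting lemmas are accordingly stated
-- for total injective relations. The ends can be read off the vertex set because distances along a
-- geodesic are distances in the graph. They come back only as an unordered pair, which is why every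
-- pair is listed with its smaller vertex first. The convexity step compares m(m+1)/2 with the line
-- through its values at q and q+1. At the integers the function is never below this line and meets
-- it only at those two arguments. The excess is carried along as an explicit number: being
-- nonnegative it gives the bound, and being zero it forces every size to be q or q+1. For the
-- converse an upper estimate suffices, because the lower bound holds for every graph. What keeps
-- the intervals few enough is that none of them can pass from one path to the next.

module _ {A : Set} where

  ∈-sublists⁻ : ∀ {S} (xs : List A) → S ∈ sublists xs → S ⊆ xs
  ∈-sublists⁻ []       (here refl) = []
  ∈-sublists⁻ (x ∷ xs) S∈ with ∈-++⁻ (map (x ∷_) (sublists xs)) S∈
  ... | inj₂ S∈xs = x ∷ʳ ∈-sublists⁻ xs S∈xs
  ... | inj₁ S∈x with ∈-map⁻ (x ∷_) S∈x
  ...   | _ , S′∈xs , refl = refl ∷ ∈-sublists⁻ xs S′∈xs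

  ∈-sublists⁺ : ∀ {S xs : List A} → S ⊆ xs → S ∈ sublists xs
  ∈-sublists⁺ []         = here refl
  ∈-sublists⁺ (y ∷ʳ S⊆)  = ∈-++⁺ʳ (map (y ∷_) _) (∈-sublists⁺ S⊆)
  ∈-sublists⁺ (refl ∷ S⊆) = ∈-++⁺ˡ (∈-map⁺ (_ ∷_) (∈-sublists⁺ S⊆))

  Unique-sublists : {xs : List A} → Unique xs → Unique (sublists xs)
  Unique-sublists {[]}     _          = [] ∷ []
  Unique-sublists {x ∷ xs} uxs@(_ ∷ u) =
    Unique-++⁺ (Unique-map⁺ (λ { refl → refl }) (Unique-sublists u)) (Unique-sublists u)
      λ (S∈x , S∈xs) → disjoint S∈x S∈xs
    where
    disjoint : ∀ {S} → S ∈ map (x ∷_) (sublists xs) → S ∈ sublists xs → ⊥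
    disjoint S∈x S∈xs with ∈-map⁻ (x ∷_) S∈x
    ... | _ , _ , refl = Unique[x∷xs]⇒x∉xs uxs (⊆-lookup (∈-sublists⁻ xs S∈xs) (here refl))

  -- Sublists inherit the order of `xs`, so in the absence of repetitions the list is recovered from
  -- its members. This turns equality of vertex sets and of edge sets into equality of lists.
  ⊆-extensional : ∀ {S S′ xs : List A} → Unique xs → S ⊆ xs → S′ ⊆ xs →
                  (∀ {x} → x ∈ S → x ∈ S′) → (∀ {x} → x ∈ S′ → x ∈ S) → S ≡ S′
  ⊆-extensional u [] [] to from = refl
  ⊆-extensional (_ ∷ u) (_ ∷ʳ p) (_ ∷ʳ q) to from = ⊆-extensional u p q to from
  ⊆-extensional u (_ ∷ʳ p) (refl ∷ q) to from =
    contradiction (⊆-lookup p (from (here refl))) (Unique[x∷xs]⇒x∉xs u)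
  ⊆-extensional u (refl ∷ p) (_ ∷ʳ q) to from =
    contradiction (⊆-lookup q (to (here refl))) (Unique[x∷xs]⇒x∉xs u)
  ⊆-extensional u@(_ ∷ u′) (refl ∷ p) (refl ∷ q) to from =
    cong (_ ∷_) (⊆-extensional u′ p q (λ x∈ → drop (⊆-lookup p x∈) (to (there x∈)))
                                      (λ x∈ → drop (⊆-lookup q x∈) (from (there x∈))))
    where
    drop : ∀ {x ys} → x ∈ _ → x ∈ _ ∷ ys → x ∈ ys
    drop x∈xs (here refl) = contradiction x∈xs (Unique[x∷xs]⇒x∉xs u)
    drop x∈xs (there x∈)  = x∈

  Unique-resp-⊆ : ∀ {S xs : List A} → S ⊆ xs → Unique xs → Unique S
  Unique-resp-⊆ []          _        = []
  Unique-resp-⊆ (_ ∷ʳ p)    (_ ∷ u)  = Unique-resp-⊆ p u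
  Unique-resp-⊆ (refl ∷ p)  (x≢ ∷ u) = All-anti-mono (⊆-lookup p) x≢ ∷ Unique-resp-⊆ p u

-- Counting along injective relations

module _ {A B : Set} where

  Unique-concatMap : ∀ {f : A → List B} {xs} → Unique xs → (∀ {x} → x ∈ xs → Unique (f x)) →
                     (∀ {x y z} → x ∈ xs → y ∈ xs → z ∈ f x → z ∈ f y → x ≡ y) →
                     Unique (concatMap f xs)
  Unique-concatMap {xs = []}         u uf sep = []
  Unique-concatMap {f} {xs = x ∷ xs} uxs@(_ ∷ u) uf sep =
    Unique-++⁺ (uf (here refl))
      (Unique-concatMap u (uf ∘ there) (λ x∈ y∈ → sep (there x∈) (there y∈)))
      λ (z∈fx , z∈rest) → disjoint z∈fx (find (∈-concatMap⁻ f z∈rest))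
    where
    disjoint : ∀ {z} → z ∈ f x → (∃ λ y → y ∈ xs × z ∈ f y) → ⊥
    disjoint z∈fx (y , y∈xs , z∈fy) with sep (here refl) (there y∈xs) z∈fx z∈fy
    ... | refl = Unique[x∷xs]⇒x∉xs uxs y∈xs

  module _ (R : A → B → Set) where

    -- The partners `us` are drawn from `ys` one at a time. A partner of the new `x` cannot be among
    -- those already drawn, since it would then be shared with another element of `xs`. The
    -- remainder `vs` is kept because its emptiness is what separates a bijection from a mere
    -- inequality.
    matching : ∀ {xs ys} → Unique xs →
               (∀ {x} → x ∈ xs → ∃ λ y → y ∈ ys × R x y) →
               (∀ {x x′ y} → x ∈ xs → x′ ∈ xs → R x y → R x′ y → x ≡ x′) →
               ∃₂ λ us vs → Pointwise R xs us × ys ↭ us ++ vs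
    matching {[]}     {ys} u tot inj = [] , ys , [] , ↭-refl
    matching {x ∷ xs} {ys} uxs@(_ ∷ u) tot inj
      with matching u (tot ∘ there) (λ a b → inj (there a) (there b)) | tot (here refl)
    ... | us , vs , Rxs , perm | y , y∈ys , Rxy with ∈-++⁻ us (∈-resp-↭ perm y∈ys)
    ...   | inj₁ y∈us = ⊥-elim (Unique[x∷xs]⇒x∉xs uxs (preimage Rxs y∈us there))
      where
      preimage : ∀ {xs′ us′} → Pointwise R xs′ us′ → y ∈ us′ → (∀ {z} → z ∈ xs′ → z ∈ x ∷ xs) → x ∈ xs′
      preimage (r ∷ _)  (here refl) sub = here (inj (here refl) (sub (here refl)) Rxy r)
      preimage (_ ∷ rs) (there y∈)  sub = there (preimage rs y∈ (sub ∘ there))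
    ...   | inj₂ y∈vs with ∈-∃++ y∈vs
    ...     | vs₁ , vs₂ , refl = y ∷ us , vs₁ ++ vs₂ , Rxy ∷ Rxs ,
              ↭-trans perm (↭-trans (↭-++⁺ˡ us (shift y vs₁ vs₂)) (shift y us (vs₁ ++ vs₂)))

    length-injection : ∀ {xs ys} → Unique xs →
               (∀ {x} → x ∈ xs → ∃ λ y → y ∈ ys × R x y) →
               (∀ {x x′ y} → x ∈ xs → x′ ∈ xs → R x y → R x′ y → x ≡ x′) →
               length xs ≤ length ys
    length-injection {xs} {ys} u tot inj with matching u tot inj
    ... | us , vs , Rxs , perm = begin
      length xs              ≡⟨ Pointwise-length Rxs ⟩
      length us              ≤⟨ m≤m+n _ _ ⟩
      length us + length vs  ≡⟨ length-++ us ⟨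
      length (us ++ vs)      ≡⟨ ↭-length perm ⟨
      length ys              ∎
      where open ≤-Reasoning

    -- The length hypothesis leaves no room for a remainder in `matching`, so every `y` is one of
    -- the partners drawn.
    injection-onto : ∀ {xs ys} → Unique xs →
               (∀ {x} → x ∈ xs → ∃ λ y → y ∈ ys × R x y) →
               (∀ {x x′ y} → x ∈ xs → x′ ∈ xs → R x y → R x′ y → x ≡ x′) →
               length ys ≤ length xs → ∀ {y} → y ∈ ys → ∃ λ x → x ∈ xs × R x y
    injection-onto {xs} {ys} u tot inj le y∈ys with matching u tot inj
    ... | us , [] , Rxs , perm = [ preimage Rxs , (λ ()) ]′ (∈-++⁻ us (∈-resp-↭ perm y∈ys))
      where
      preimage : ∀ {xs us y} → Pointwise R xs us → y ∈ us → ∃ λ x → x ∈ xs × R x y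
      preimage (r ∷ _)  (here refl) = _ , here refl , r
      preimage (_ ∷ rs) (there y∈)  = let x , x∈ , r = preimage rs y∈ in x , there x∈ , r
    ... | us , v ∷ vs , Rxs , perm = contradiction le (<⇒≱ (begin-strict
      length xs                    ≡⟨ Pointwise-length Rxs ⟩
      length us                    <⟨ m<m+n _ (s≤s z≤n) ⟩
      length us + length (v ∷ vs)  ≡⟨ length-++ us ⟨
      length (us ++ v ∷ vs)        ≡⟨ ↭-length perm ⟨
      length ys                    ∎))
      where open ≤-Reasoning

length-concatMap : ∀ {A B : Set} (f : A → List B) xs → length (concatMap f xs) ≡ sum (map (length ∘ f) xs)
length-concatMap f []       = refl
length-concatMap f (x ∷ xs) = trans (length-++ (f x)) (cong (length (f x) +_) (length-concatMap f xs))

Unique-length-≤ : ∀ {A : Set} {xs ys : List A} → Unique xs → (∀ {x} → x ∈ xs → x ∈ ys) →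
                  length xs ≤ length ys
Unique-length-≤ u sub = length-injection _≡_ u (λ x∈ → _ , sub x∈ , refl) λ { _ _ refl refl → refl }

-- Connectedness and the list of connected subgraphs

xor-≢ : ∀ {x y} → T (x xor y) → x ≢ y
xor-≢ {false} {true}  _ ()
xor-≢ {true}  {false} _ ()

≢-xor : ∀ {x y} → ¬ T (x xor y) → x ≡ y
≢-xor {false} {false} _  = refl
≢-xor {false} {true}  ¬t = contradiction tt ¬t
≢-xor {true}  {false} ¬t = contradiction tt ¬t
≢-xor {true}  {true}  _  = refl

T-⇔⇒≡ : ∀ {x y} → (T x → T y) → (T y → T x) → x ≡ y
T-⇔⇒≡ {false} {false} _ _ = refl
T-⇔⇒≡ {false} {true}  _ g = ⊥-elim (g tt)
T-⇔⇒≡ {true}  {false} f _ = ⊥-elim (f tt)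
T-⇔⇒≡ {true}  {true}  _ _ = refl

module _ {n : ℕ} where

  ∈ᵇ⇒∈ : ∀ {v : Fin n} {S} → T (v ∈ᵇ S) → v ∈ S
  ∈ᵇ⇒∈ {v} {S} t = Any.map (λ {u} → witness u) (any⁻ _ S t)
    where
    witness : ∀ u → T (does (u Fin.≟ v)) → v ≡ u
    witness u t with u Fin.≟ v
    ... | yes refl = refl

  ∈⇒∈ᵇ : ∀ {v : Fin n} {S} → v ∈ S → T (v ∈ᵇ S)
  ∈⇒∈ᵇ {v} v∈S = any⁺ _ (Any.map (λ { refl → subst T (≡-sym (dec-true (v Fin.≟ v) refl)) tt }) v∈S)

  -- Separations are replaced by two-colourings: a colouring constant along the edges is constant on
  -- `V`. A colouring is defined on all vertices, so each later argument can supply its own cut,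
  -- such as membership in a closed set or a threshold on labels.
  record IsConnected (V : List (Fin n)) (E : List (Edge {n})) : Set where
    field
      nonempty : ∃ λ v → v ∈ V
      cohesive : (c : Fin n → Bool) → (∀ {a b} → (a , b) ∈ E → c a ≡ c b) →
                 ∀ {u v} → u ∈ V → v ∈ V → c u ≡ c v
  open IsConnected public

  -- If no edge crosses a nonempty `S`, membership in `S` is a colouring constant along the edges.
  -- Then all of `V` lies in `S`, and the lengths agree.
  connected⁺ : ∀ {V E} → Unique V → IsConnected V E → T (connected V E)
  connected⁺ {V} {E} uV conn = Equivalence.from T-∧
    ( notNull (proj₂ (nonempty conn))
    , all⁻ _ (All.tabulate λ {S} S∈ → noSeparation S (∈-sublists⁻ V S∈)))
    where
    notNull : ∀ {v V} → v ∈ V → T (not (null V))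
    notNull (here _)  = tt
    notNull (there _) = tt
    noSeparation : ∀ S → S ⊆ V → T (null S ∨ (length S ≡ᵇ length V) ∨ crosses E S)
    noSeparation []      S⊆V = tt
    noSeparation (s ∷ S) S⊆V with T? (crosses E (s ∷ S))
    ... | yes cr = Equivalence.from (T-∨ {length (s ∷ S) ≡ᵇ length V}) (inj₂ cr)
    ... | no ¬cr = Equivalence.from T-∨ (inj₁ (≡⇒≡ᵇ (length (s ∷ S)) (length V)
                     (≤-antisym (length-mono-≤ S⊆V) (Unique-length-≤ uV V⊆S))))
      where
      uncrossed : ∀ {a b} → (a , b) ∈ E → a ∈ᵇ (s ∷ S) ≡ b ∈ᵇ (s ∷ S)
      uncrossed ab∈E = ≢-xor λ t → ¬cr (any⁺ _ (lose ab∈E t))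
      V⊆S : ∀ {v} → v ∈ V → v ∈ s ∷ S
      V⊆S v∈V = ∈ᵇ⇒∈ (subst T (cohesive conn (_∈ᵇ (s ∷ S)) uncrossed (⊆-lookup S⊆V (here refl)) v∈V)
                              (∈⇒∈ᵇ {s} {s ∷ S} (here refl)))

  -- The boolean test is evaluated at the colour class of `c` inside `V`. If the class is empty or
  -- everything, `c` is constant; if an edge crosses it, that edge has ends of different colours.
  -- The hypothesis on endpoints makes membership in the class agree with `c` there.
  connected⁻ : ∀ {V E} → (∀ {a b} → (a , b) ∈ E → a ∈ V × b ∈ V) → T (connected V E) → IsConnected V E
  connected⁻ {V} {E} ends t = record { nonempty = member V (proj₁ parts) ; cohesive = coh }
    where
    parts = Equivalence.to (T-∧ {not (null V)}) t
    member : ∀ V → T (not (null V)) → ∃ λ v → v ∈ V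
    member (v ∷ _) _ = v , here refl
    coh : (c : Fin n → Bool) → (∀ {a b} → (a , b) ∈ E → c a ≡ c b) →
          ∀ {u v} → u ∈ V → v ∈ V → c u ≡ c v
    coh c const {u} {v} u∈V v∈V
      with Equivalence.to (T-∨ {null S}) (All.lookup (all⁺ _ _ (proj₂ parts)) (∈-sublists⁺ (filter-⊆ (T? ∘ c) V)))
      where S = filterᵇ c V
    ... | inj₁ isnull = T-⇔⇒≡ (λ cu → ⊥-elim (absurd isnull (∈-filter⁺ (T? ∘ c) u∈V cu)))
                               (λ cv → ⊥-elim (absurd isnull (∈-filter⁺ (T? ∘ c) v∈V cv)))
      where
      absurd : ∀ {x : Fin n} {S} → T (null S) → x ∈ S → ⊥
      absurd {S = _ ∷ _} () _
    ... | inj₂ t′ with Equivalence.to (T-∨ {length (filterᵇ c V) ≡ᵇ length V}) t′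
    ...   | inj₁ len = T-⇔⇒≡ (λ _ → every v∈V) (λ _ → every u∈V)
      where
      every : ∀ {x} → x ∈ V → T (c x)
      every x∈V = proj₂ (∈-filter⁻ (T? ∘ c) {xs = V} (subst (_ ∈_) (≡-sym
                    (filter-complete (T? ∘ c) (≡ᵇ⇒≡ (length (filterᵇ c V)) (length V) len))) x∈V))
    ...   | inj₂ cr with find (any⁻ _ E cr)
    ...     | (a , b) , ab∈E , xr = contradiction
              (T-⇔⇒≡ (move (const ab∈E) (proj₂ (ends ab∈E))) (move (≡-sym (const ab∈E)) (proj₁ (ends ab∈E)))) (xor-≢ xr)
      where
      move : ∀ {x y} → c x ≡ c y → y ∈ V → T (x ∈ᵇ filterᵇ c V) → T (y ∈ᵇ filterᵇ c V)
      move eq y∈V t = ∈⇒∈ᵇ (∈-filter⁺ (T? ∘ c) y∈V (subst T eq (proj₂ (∈-filter⁻ (T? ∘ c) {xs = V} (∈ᵇ⇒∈ t)))))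

  module _ (G : Graph n) where

    private
      cell : Fin n → Fin n → List Edge
      cell i j = if adj G i j ∧ (toℕ i <ᵇ toℕ j) then [ (i , j) ] else []

      ∈-cell⁻ : ∀ {i j e} → e ∈ cell i j → e ≡ (i , j) × adj G i j ≡ true × toℕ i < toℕ j
      ∈-cell⁻ {i} {j} e∈ with adj G i j | toℕ i <ᵇ toℕ j in lt
      ∈-cell⁻ {i} {j} (here refl) | true | true = refl , refl , <ᵇ⇒< _ _ (Equivalence.from T-≡ lt)

      ∈-cell⁺ : ∀ {i j} → adj G i j ≡ true → toℕ i < toℕ j → (i , j) ∈ cell i j
      ∈-cell⁺ {i} {j} ad lt with adj G i j | toℕ i <ᵇ toℕ j | <⇒<ᵇ lt
      ... | true | true | _ = here refl

      Unique-cell : ∀ i j → Unique (cell i j)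
      Unique-cell i j with adj G i j ∧ (toℕ i <ᵇ toℕ j)
      ... | true  = [] ∷ []
      ... | false = []

    ∈-edges⁻ : ∀ {i j} → (i , j) ∈ edges G → adj G i j ≡ true × toℕ i < toℕ j
    ∈-edges⁻ e∈ with find (∈-concatMap⁻ _ {xs = allFin n} e∈)
    ... | i , _ , e∈i with find (∈-concatMap⁻ (cell i) {xs = allFin n} e∈i)
    ...   | j , _ , e∈ij with ∈-cell⁻ e∈ij
    ...     | refl , ad , lt = ad , lt

    ∈-edges⁺ : ∀ {i j} → adj G i j ≡ true → toℕ i < toℕ j → (i , j) ∈ edges G
    ∈-edges⁺ {i} {j} ad lt = ∈-concatMap⁺ _ (lose (∈-allFin i) (∈-concatMap⁺ (cell i) (lose (∈-allFin j) (∈-cell⁺ ad lt))))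

    Unique-edges : Unique (edges G)
    Unique-edges = Unique-concatMap (allFin⁺ n)
      (λ {i} _ → Unique-concatMap (allFin⁺ n) (λ {j} _ → Unique-cell i j)
        λ _ _ e∈ e∈′ → cong proj₂ (trans (≡-sym (proj₁ (∈-cell⁻ e∈))) (proj₁ (∈-cell⁻ e∈′))))
      λ _ _ e∈ e∈′ → trans (≡-sym (source e∈)) (source e∈′)
      where
      source : ∀ {i e} → e ∈ concatMap (cell i) (allFin n) → proj₁ e ≡ i
      source {i} e∈ = let j , _ , e∈ij = find (∈-concatMap⁻ (cell i) {xs = allFin n} e∈) in cong proj₁ (proj₁ (∈-cell⁻ e∈ij))

    adj-edge : ∀ {a b} → adj G a b ≡ true → (a , b) ∈ edges G ⊎ (b , a) ∈ edges G
    adj-edge {a} {b} ad with <-cmp (toℕ a) (toℕ b)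

    ... | tri< lt _ _ = inj₁ (∈-edges⁺ ad lt)
    ... | tri> _ _ gt = inj₂ (∈-edges⁺ (trans (sym G b a) ad) gt)
    ... | tri≈ _ eq _ with toℕ-injective eq
    ...   | refl = contradiction (trans (≡-sym ad) (irrefl G a)) λ ()

    record IsConnectedSubgraph (V : List (Fin n)) (E : List Edge) : Set where
      field
        V⊆        : V ⊆ allFin n
        E⊆        : E ⊆ edges G
        endpoints : ∀ {a b} → (a , b) ∈ E → a ∈ V × b ∈ V
        isConn    : IsConnected V E
    open IsConnectedSubgraph public

    -- The list whose length is `F G` forgets the vertex sets and so has repetitions, such as the
    -- empty edge set once for each single vertex. Keeping `V` beside `E` gives a repetition-free
    -- list of the same length, to which injections apply.
    subgraphs : List (List (Fin n) × List Edge)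
    subgraphs = concatMap (λ V → map (V ,_) (filterᵇ (isConnSub V) (sublists (edges G)))) (sublists (allFin n))

    length-subgraphs : length subgraphs ≡ F G
    length-subgraphs = go (sublists (allFin n))
      where
      go : ∀ Vs → length (concatMap (λ V → map (V ,_) (filterᵇ (isConnSub V) (sublists (edges G)))) Vs)
                ≡ length (concatMap (λ V → filterᵇ (isConnSub V) (sublists (edges G))) Vs)
      go []       = refl
      go (V ∷ Vs) = trans (length-++ (map (V ,_) Es)) (trans (cong₂ _+_ (length-map (V ,_) Es) (go Vs))
                      (≡-sym (length-++ Es)))
        where Es = filterᵇ (isConnSub V) (sublists (edges G))

    ∈-subgraphs⁺ : ∀ {V E} → IsConnectedSubgraph V E → (V , E) ∈ subgraphs
    ∈-subgraphs⁺ {V} {E} H = ∈-concatMap⁺ _ (lose (∈-sublists⁺ (V⊆ H)) (∈-map⁺ (V ,_)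
      (∈-filter⁺ (T? ∘ isConnSub V) (∈-sublists⁺ (E⊆ H)) (Equivalence.from T-∧
        ( all⁻ _ (All.tabulate λ {e} e∈ → Equivalence.from T-∧ (∈⇒∈ᵇ (proj₁ (endpoints H e∈)) , ∈⇒∈ᵇ (proj₂ (endpoints H e∈))))
        , connected⁺ (Unique-resp-⊆ (V⊆ H) (allFin⁺ n)) (isConn H))))))

    ∈-subgraphs⁻ : ∀ {V E} → (V , E) ∈ subgraphs → IsConnectedSubgraph V E
    ∈-subgraphs⁻ {V} {E} VE∈ with find (∈-concatMap⁻ _ {xs = sublists (allFin n)} VE∈)
    ... | V , V∈ , VE∈′ with ∈-map⁻ (V ,_) VE∈′
    ...   | E , E∈ , refl with ∈-filter⁻ (T? ∘ isConnSub V) {xs = sublists (edges G)} E∈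
    ...     | E∈′ , t = record
              { V⊆ = ∈-sublists⁻ _ V∈ ; E⊆ = ∈-sublists⁻ _ E∈′ ; endpoints = ends
              ; isConn = connected⁻ ends (proj₂ parts) }
      where
      parts = Equivalence.to T-∧ t
      ends : ∀ {a b} → (a , b) ∈ E → a ∈ V × b ∈ V
      ends ab∈ = let p , q = Equivalence.to T-∧ (All.lookup (all⁺ _ E (proj₁ parts)) ab∈) in ∈ᵇ⇒∈ p , ∈ᵇ⇒∈ q

    Unique-subgraphs : Unique subgraphs
    Unique-subgraphs = Unique-concatMap (Unique-sublists (allFin⁺ n))
      (λ {V} _ → Unique-map⁺ (λ { refl → refl }) (Unique-filter⁺ (T? ∘ isConnSub V) (Unique-sublists Unique-edges)))
      λ _ _ p q → trans (≡-sym (fst p)) (fst q)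
      where
      fst : ∀ {V VE Es} → VE ∈ map (V ,_) Es → proj₁ VE ≡ V
      fst p = let _ , _ , eq = ∈-map⁻ _ p in cong proj₁ eq

-- Geodesics and components

tri : ℕ → ℕ
tri zero    = 0
tri (suc m) = suc m + tri m

-- Meant for the positions `a` and `b` of two vertices on a geodesic of length `l`: if they are at
-- least `l` apart, they are its ends.
full-length : ∀ {a b l} → a ≤ b → b ≤ l → l ≤ b ∸ a → a ≡ 0 × b ≡ l
full-length {a} {b} {l} a≤b b≤l l≤b∸a = n≤0⇒n≡0 (+-cancelʳ-≤ l a 0 (begin
    a + l        ≤⟨ +-monoʳ-≤ a l≤b∸a ⟩
    a + (b ∸ a)  ≡⟨ m+[n∸m]≡n a≤b ⟩
    b            ≤⟨ b≤l ⟩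
    l            ∎))
  , ≤-antisym b≤l (≤-trans l≤b∸a (m∸n≤m b a))
  where open ≤-Reasoning

-- Each unordered pair of positions, equal ones included, appears once with the earlier entry in
-- front. On an increasing list this orients every pair.
pairs : ∀ {A : Set} → List A → List (A × A)
pairs []       = []
pairs (x ∷ xs) = map (x ,_) (x ∷ xs) ++ pairs xs

module _ {A : Set} where

  length-pairs : (xs : List A) → length (pairs xs) ≡ tri (length xs)
  length-pairs []       = refl
  length-pairs (x ∷ xs) = trans (length-++ (map (x ,_) (x ∷ xs))) (cong₂ _+_ (length-map _ (x ∷ xs)) (length-pairs xs))

  ∈-pairs⁻ : ∀ {u v} {xs : List A} → (u , v) ∈ pairs xs → u ∈ xs × v ∈ xs
  ∈-pairs⁻ {xs = x ∷ xs} uv∈ with ∈-++⁻ (map (x ,_) (x ∷ xs)) uv∈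
  ... | inj₁ p with ∈-map⁻ (x ,_) p
  ...   | v , v∈ , refl = here refl , v∈
  ∈-pairs⁻ {xs = x ∷ xs} uv∈ | inj₂ p = let u∈ , v∈ = ∈-pairs⁻ p in there u∈ , there v∈

  pairs-ordered : ∀ {R : A → A → Set} {u v xs} → AllPairs R xs → (u , v) ∈ pairs xs → u ≡ v ⊎ R u v
  pairs-ordered {xs = x ∷ xs} (Rx ∷ Rxs) uv∈ with ∈-++⁻ (map (x ,_) (x ∷ xs)) uv∈
  ... | inj₂ p = pairs-ordered Rxs p
  ... | inj₁ p with ∈-map⁻ (x ,_) p
  ...   | _ , here refl , refl = inj₁ refl
  ...   | _ , there v∈  , refl = inj₂ (All.lookup Rx v∈)

  Unique-pairs : {xs : List A} → Unique xs → Unique (pairs xs)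
  Unique-pairs []             = []
  Unique-pairs {x ∷ xs} uxs@(_ ∷ u) = Unique-++⁺ (Unique-map⁺ (λ { refl → refl }) uxs) (Unique-pairs u)
    λ (p , q) → disjoint p q
    where
    disjoint : ∀ {e} → e ∈ map (x ,_) (x ∷ xs) → e ∈ pairs xs → ⊥
    disjoint p q with ∈-map⁻ (x ,_) p
    ... | _ , _ , refl = Unique[x∷xs]⇒x∉xs uxs (proj₁ (∈-pairs⁻ q))

module _ {n : ℕ} where

  sorted : ∀ {S} → S ⊆ allFin n → AllPairs Fin._<_ S
  sorted S⊆ = go S⊆ (tabulate⁺-< id)
    where
    go : ∀ {S xs} → S ⊆ xs → AllPairs Fin._<_ xs → AllPairs Fin._<_ S
    go []         _        = []
    go (_ ∷ʳ p)   (_ ∷ s)  = go p s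
    go (refl ∷ p) (x< ∷ s) = All-anti-mono (⊆-lookup p) x< ∷ go p s

  subset : (Fin n → Bool) → List (Fin n)
  subset c = filterᵇ c (allFin n)

  subset-⊆ : ∀ c → subset c ⊆ allFin n
  subset-⊆ c = filter-⊆ (T? ∘ c) (allFin n)

  ∈-subset⁺ : ∀ c {v} → T (c v) → v ∈ subset c
  ∈-subset⁺ c t = ∈-filter⁺ (T? ∘ c) (∈-allFin _) t

  ∈-subset⁻ : ∀ c {v} → v ∈ subset c → T (c v)
  ∈-subset⁻ c v∈ = proj₂ (∈-filter⁻ (T? ∘ c) {xs = allFin n} v∈)

  subset-ext : ∀ {S S′} → S ⊆ allFin n → S′ ⊆ allFin n →
               (∀ {x} → x ∈ S → x ∈ S′) → (∀ {x} → x ∈ S′ → x ∈ S) → S ≡ S′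
  subset-ext = ⊆-extensional (allFin⁺ n)

module _ {n : ℕ} (G : Graph n) where

  adj-sym : ∀ {a b} → adj G a b ≡ true → adj G b a ≡ true
  adj-sym {a} {b} ad = trans (sym G b a) ad

  ∈-induced⁻ : ∀ {V a b} → (a , b) ∈ induced G V → (a , b) ∈ edges G × a ∈ V × b ∈ V
  ∈-induced⁻ {V} ab∈ with ∈-filter⁻ (T? ∘ _) {xs = edges G} ab∈
  ... | e , t = let p , q = Equivalence.to T-∧ t in e , ∈ᵇ⇒∈ p , ∈ᵇ⇒∈ q

  ∈-induced⁺ : ∀ {V a b} → (a , b) ∈ edges G → a ∈ V → b ∈ V → (a , b) ∈ induced G V
  ∈-induced⁺ e a∈ b∈ = ∈-filter⁺ (T? ∘ _) e (Equivalence.from T-∧ (∈⇒∈ᵇ a∈ , ∈⇒∈ᵇ b∈))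

  induced-subgraph : ∀ {V} → V ⊆ allFin n → (∃ λ v → v ∈ V) →
    (∀ (c : Fin n → Bool) → (∀ {a b} → a ∈ V → b ∈ V → adj G a b ≡ true → c a ≡ c b) →
       ∀ {u v} → u ∈ V → v ∈ V → c u ≡ c v) →
    IsConnectedSubgraph G V (induced G V)
  induced-subgraph {V} V⊆ ne coh = record
    { V⊆ = V⊆ ; E⊆ = filter-⊆ (T? ∘ _) (edges G) ; endpoints = proj₂ ∘ ∈-induced⁻
    ; isConn = record { nonempty = ne ; cohesive = λ c const → coh c λ a∈ b∈ ad →
        [ (λ e → const (∈-induced⁺ e a∈ b∈)) , (λ e → ≡-sym (const (∈-induced⁺ e b∈ a∈))) ]′ (adj-edge G ad) } }

  data Walk : ℕ → Fin n → Fin n → Set where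
    stay : ∀ {u} → Walk 0 u u
    step : ∀ {l u v w} → adj G u v ≡ true → Walk l v w → Walk (suc l) u w

  _◅◅_ : ∀ {l m u v w} → Walk l u v → Walk m v w → Walk (l + m) u w
  stay     ◅◅ s = s
  step e r ◅◅ s = step e (r ◅◅ s)

  snoc : ∀ {l u v w} → Walk l u v → adj G v w ≡ true → Walk (suc l) u w
  snoc stay       e′ = step e′ stay
  snoc (step e r) e′ = step e (snoc r e′)

  reverse : ∀ {l u v} → Walk l u v → Walk l v u
  reverse stay       = stay
  reverse (step e r) = snoc (reverse r) (adj-sym e)

  walk? : ∀ l u v → Dec (Walk l u v)
  walk? zero    u v = map′ (λ { refl → stay }) (λ { stay → refl }) (u Fin.≟ v)
  walk? (suc l) u v = map′ (λ (w , e , r) → step e r) (λ { (step e r) → _ , e , r })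
    (Finₚ.any? λ w → (adj G u w ≟ᵇ true) ×-dec walk? l w v)

  vertexAt : ∀ {l u v} → Walk l u v → ℕ → Fin n
  vertexAt {u = u} stay       _       = u
  vertexAt {u = u} (step _ r) zero    = u
  vertexAt         (step _ r) (suc i) = vertexAt r i

  vertexAt-first : ∀ {l u v} (r : Walk l u v) → vertexAt r 0 ≡ u
  vertexAt-first stay       = refl
  vertexAt-first (step _ _) = refl

  vertexAt-last : ∀ {l u v} (r : Walk l u v) → vertexAt r l ≡ v
  vertexAt-last stay       = refl
  vertexAt-last (step _ r) = vertexAt-last r

  vertexAt-adj : ∀ {l u v} (r : Walk l u v) {i} → i < l → adj G (vertexAt r i) (vertexAt r (suc i)) ≡ true
  vertexAt-adj (step e r) {zero}  _         = trans (cong (adj G _) (vertexAt-first r)) e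
  vertexAt-adj (step _ r) {suc i} (s≤s i<l) = vertexAt-adj r i<l

  -- `at` is total on ℕ so that positions are subject to plain arithmetic; only its values up to
  -- `len` matter. Minimality is stated against arbitrary walks, since these can be spliced freely.
  record Geodesic (u v : Fin n) : Set where
    field
      len      : ℕ
      at       : ℕ → Fin n
      first    : at 0 ≡ u
      last     : at len ≡ v
      adjacent : ∀ {i} → i < len → adj G (at i) (at (suc i)) ≡ true
      shortest : ∀ {m} → Walk m u v → len ≤ m

  -- Whether a walk of a given length exists is decidable, so all shorter lengths can be searched.
  -- The descent stops at a length below which none is found.
  geodesic : ∀ {l u v} → Walk l u v → Geodesic u v
  geodesic {l} {u} {v} = <-rec (λ l → Walk l u v → Geodesic u v) shorten l
    where
    shorten : ∀ l → (∀ {m} → m < l → Walk m u v → Geodesic u v) → Walk l u v → Geodesic u v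
    shorten l rec r with anyUpTo? (λ m → walk? m u v) l
    ... | yes (m , m<l , s) = rec m<l s
    ... | no ¬shorter = record
      { len = l ; at = vertexAt r ; first = vertexAt-first r ; last = vertexAt-last r
      ; adjacent = vertexAt-adj r ; shortest = λ {m} s → ≮⇒≥ λ m<l → ¬shorter (m , m<l , s) }

  module _ {u v : Fin n} (g : Geodesic u v) where
    open Geodesic g

    segment : ∀ i d → i + d ≤ len → Walk d (at i) (at (i + d))
    segment i zero    _  = subst (λ j → Walk 0 (at i) (at j)) (≡-sym (+-identityʳ i)) stay
    segment i (suc d) le rewrite +-suc i d = snoc (segment i d (<⇒≤ le)) (adjacent le)

    segment-∸ : ∀ {i j} → i ≤ j → j ≤ len → Walk (j ∸ i) (at i) (at j)
    segment-∸ {i} {j} i≤j j≤l = subst (λ k → Walk (j ∸ i) (at i) (at k)) (m+[n∸m]≡n i≤j)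
      (segment i (j ∸ i) (≤-trans (≤-reflexive (m+[n∸m]≡n i≤j)) j≤l))

    -- Going along the geodesic to `at i`, then along the given walk, then from `at j` to the end
    -- takes at least `len` steps, so the walk cannot be a shortcut. With `m = 0` this gives
    -- distinct vertices, with `m = 1` the absence of chords.
    separation : ∀ {i j m} → i ≤ len → j ≤ len → Walk m (at i) (at j) → j ≤ i + m
    separation {i} {j} {m} i≤l j≤l w = +-cancelʳ-≤ (len ∸ j) j (i + m) (begin
      j + (len ∸ j)        ≡⟨ m+[n∸m]≡n j≤l ⟩
      len                  ≤⟨ shortest (subst (λ x → Walk i x (at i)) first (segment 0 i i≤l) ◅◅
                                (w ◅◅ subst (Walk (len ∸ j) (at j)) last (segment-∸ j≤l ≤-refl))) ⟩
      i + (m + (len ∸ j))  ≡⟨ +-assoc i m _ ⟨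
      i + m + (len ∸ j)    ∎)
      where open ≤-Reasoning

    at-injective : ∀ {i j} → i ≤ len → j ≤ len → at i ≡ at j → i ≡ j
    at-injective {i} {j} i≤l j≤l eq = ≤-antisym (le i≤l j≤l (≡-sym eq)) (le j≤l i≤l eq)
      where
      le : ∀ {i j} → i ≤ len → j ≤ len → at j ≡ at i → i ≤ j
      le {i} {j} i≤l j≤l eq = subst (i ≤_) (+-identityʳ j) (separation j≤l i≤l (subst (Walk 0 (at j)) eq stay))

    onGeodesic : Fin n → Bool
    onGeodesic w = w ∈ᵇ map at (upTo (suc len))

    -- Filtered out of `allFin n` instead of listed along `at`, so that geodesics with the same
    -- vertices yield the same list.
    vertices : List (Fin n)
    vertices = subset onGeodesic

    ∈-vertices⁺ : ∀ {i} → i ≤ len → at i ∈ vertices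
    ∈-vertices⁺ i≤l = ∈-subset⁺ onGeodesic (∈⇒∈ᵇ (∈-map⁺ at (∈-upTo⁺ (s≤s i≤l))))

    ∈-vertices⁻ : ∀ {w} → w ∈ vertices → ∃ λ i → i ≤ len × w ≡ at i
    ∈-vertices⁻ w∈ with ∈-map⁻ at (∈ᵇ⇒∈ (∈-subset⁻ onGeodesic w∈))
    ... | i , i∈ , eq = i , ≤-pred (∈-upTo⁻ i∈) , eq

    geodesic-subgraph : IsConnectedSubgraph G vertices (induced G vertices)
    geodesic-subgraph = induced-subgraph (subset-⊆ onGeodesic) (at 0 , ∈-vertices⁺ z≤n) λ c const u∈ v∈ →
      let i , i≤l , u≡ = ∈-vertices⁻ u∈
          j , j≤l , v≡ = ∈-vertices⁻ v∈
      in trans (cong c u≡) (trans (≡-sym (along c const i i≤l)) (trans (along c const j j≤l) (cong c (≡-sym v≡))))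
      where
      along : ∀ c → (∀ {a b} → a ∈ vertices → b ∈ vertices → adj G a b ≡ true → c a ≡ c b) →
              ∀ i → i ≤ len → c (at 0) ≡ c (at i)
      along c const zero    _  = refl
      along c const (suc i) lt = trans (along c const i (<⇒≤ lt))
        (const (∈-vertices⁺ (<⇒≤ lt)) (∈-vertices⁺ lt) (adjacent lt))

  open Geodesic

  -- The endpoints of a geodesic are its only two vertices at distance len.
  extremes : ∀ {u v u′ v′} (g : Geodesic u v) (g′ : Geodesic u′ v′) → len g ≤ len g′ →
             u′ ∈ vertices g → v′ ∈ vertices g → (u ≡ u′ × v ≡ v′) ⊎ (u ≡ v′ × v ≡ u′)
  extremes g g′ l≤l′ u′∈ v′∈ with ∈-vertices⁻ g u′∈ | ∈-vertices⁻ g v′∈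
  ... | a , a≤l , refl | b , b≤l , refl with ≤-total a b
  -- The segment of `g` between the two positions is a walk from `u′` to `v′`, so its length `b ∸ a`
  -- is at least `len g′`, hence at least `len g`.
  ...   | inj₁ a≤b = inj₁ (atEnds (full-length a≤b b≤l (≤-trans l≤l′ (shortest g′ (segment-∸ g a≤b b≤l)))))
    where
    atEnds : a ≡ 0 × b ≡ len g → _
    atEnds (refl , refl) = ≡-sym (first g) , ≡-sym (last g)
  ...   | inj₂ b≤a = inj₂ (atEnds (full-length b≤a a≤l (≤-trans l≤l′ (shortest g′ (reverse (segment-∸ g b≤a a≤l))))))
    where
    atEnds : b ≡ 0 × a ≡ len g → _
    atEnds (refl , refl) = ≡-sym (first g) , ≡-sym (last g)

  -- Two vertices of `g` are joined by a segment of `g`. For geodesics with a common vertex set this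
  -- supplies the comparison of lengths that `extremes` asks for.
  len-≤ : ∀ {u v u′ v′} (g : Geodesic u v) (g′ : Geodesic u′ v′) →
          u′ ∈ vertices g → v′ ∈ vertices g → len g′ ≤ len g
  len-≤ g g′ u′∈ v′∈ with ∈-vertices⁻ g u′∈ | ∈-vertices⁻ g v′∈
  ... | a , a≤l , refl | b , b≤l , refl with ≤-total a b
  ...   | inj₁ a≤b = ≤-trans (shortest g′ (segment-∸ g a≤b b≤l)) (≤-trans (m∸n≤m b a) b≤l)
  ...   | inj₂ b≤a = ≤-trans (shortest g′ (reverse (segment-∸ g b≤a a≤l))) (≤-trans (m∸n≤m a b) a≤l)

  start∈ : ∀ {u v} (g : Geodesic u v) → u ∈ vertices g
  start∈ g = subst (_∈ vertices g) (first g) (∈-vertices⁺ g z≤n)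

  end∈ : ∀ {u v} (g : Geodesic u v) → v ∈ vertices g
  end∈ g = subst (_∈ vertices g) (last g) (∈-vertices⁺ g ≤-refl)

  -- Connected components

  record IsComponent (S : List (Fin n)) : Set where
    field
      subgraph : IsConnectedSubgraph G S (induced G S)
      closed   : ∀ {a b} → a ∈ S → adj G a b ≡ true → b ∈ S
  open IsComponent public

  components : List (List (Fin n))
  components = filterᵇ (isComponent G) (sublists (allFin n))

  ∈-components⁻ : ∀ {S} → S ∈ components → IsComponent S
  ∈-components⁻ {S} S∈ with ∈-filter⁻ (T? ∘ isComponent G) {xs = sublists (allFin n)} S∈
  ... | S∈′ , t with Equivalence.to (T-∧ {connected S (induced G S)}) t
  ...   | conn , notcr = record
    { subgraph = record { V⊆ = ∈-sublists⁻ _ S∈′ ; E⊆ = filter-⊆ (T? ∘ _) (edges G)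
                        ; endpoints = proj₂ ∘ ∈-induced⁻ ; isConn = connected⁻ (proj₂ ∘ ∈-induced⁻) conn }
    ; closed = λ a∈ ad → [ (λ e → ∈ᵇ⇒∈ (subst T (uncrossed e) (∈⇒∈ᵇ a∈)))
                         , (λ e → ∈ᵇ⇒∈ (subst T (≡-sym (uncrossed e)) (∈⇒∈ᵇ a∈))) ]′ (adj-edge G ad) }
    where
    T-not : ∀ {x} → T (not x) → ¬ T x
    T-not {false} _ ()
    uncrossed : ∀ {a b} → (a , b) ∈ edges G → a ∈ᵇ S ≡ b ∈ᵇ S
    uncrossed e = ≢-xor λ x → T-not notcr (any⁺ _ (lose e x))

  ∈-components⁺ : ∀ {S} → IsComponent S → S ∈ components
  ∈-components⁺ {S} C = ∈-filter⁺ (T? ∘ isComponent G) (∈-sublists⁺ (V⊆ (subgraph C))) (Equivalence.from T-∧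
    (connected⁺ (Unique-resp-⊆ (V⊆ (subgraph C)) (allFin⁺ n)) (isConn (subgraph C)) , not-T notcr))
    where
    not-T : ∀ {x} → ¬ T x → T (not x)
    not-T {false} _ = tt
    not-T {true}  f = f tt
    notcr : ¬ T (crosses (edges G) S)
    notcr t with find (any⁻ _ (edges G) t)
    ... | (a , b) , e , x = xor-≢ x (T-⇔⇒≡
            (λ a∈ → ∈⇒∈ᵇ (closed C (∈ᵇ⇒∈ a∈) (proj₁ (∈-edges⁻ G e))))
            (λ b∈ → ∈⇒∈ᵇ (closed C (∈ᵇ⇒∈ b∈) (adj-sym (proj₁ (∈-edges⁻ G e))))))

  record Closure (u : Fin n) : Set where
    field
      reached   : List (Fin n)
      base      : u ∈ reached
      reachable : ∀ {x} → x ∈ reached → ∃ λ l → Walk l u x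
      saturated : ∀ {a b} → a ∈ reached → adj G a b ≡ true → b ∈ reached

  closure : ∀ u → Closure u
  closure u = grow n [ u ] ([] ∷ []) (m≤m+n n 1) (here refl) λ { (here refl) → 0 , stay }
    where
    _∈?_ = ∈-dec Fin._≟_
    grow : ∀ fuel xs → Unique xs → n ≤ fuel + length xs → u ∈ xs →
           (∀ {x} → x ∈ xs → ∃ λ l → Walk l u x) → Closure u
    grow fuel xs uxs bound u∈ reach
      with Finₚ.any? (λ a → Finₚ.any? λ b → (a ∈? xs) ×-dec (¬? (b ∈? xs) ×-dec (adj G a b ≟ᵇ true)))
    ... | no ¬exit = record { reached = xs ; base = u∈ ; reachable = reach ; saturated = sat }
      where
      sat : ∀ {a b} → a ∈ xs → adj G a b ≡ true → b ∈ xs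
      sat {a} {b} a∈ ad with b ∈? xs
      ... | yes b∈ = b∈
      ... | no b∉  = contradiction (a , b , a∈ , b∉ , ad) ¬exit
    ... | yes (a , b , a∈ , b∉ , ad) with fuel
    -- Every round spends one unit of fuel and gains one vertex. With the fuel gone, `xs` already
    -- has at least `n` distinct entries, and `b` would be one too many.
    ...   | zero = contradiction
              (subst (length (b ∷ xs) ≤_) (length-tabulate {n = n} id) (Unique-length-≤ ubxs (λ _ → ∈-allFin _)))
              (<⇒≱ (s≤s bound))
      where ubxs = ¬Any⇒All¬ xs b∉ ∷ uxs
    ...   | suc fuel′ = grow fuel′ (b ∷ xs) (¬Any⇒All¬ xs b∉ ∷ uxs)
              (subst (n ≤_) (≡-sym (+-suc fuel′ (length xs))) bound) (there u∈) reach′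
      where
      reach′ : ∀ {x} → x ∈ b ∷ xs → ∃ λ l → Walk l u x
      reach′ (here refl) = let l , w = reach a∈ in suc l , snoc w ad
      reach′ (there x∈)  = reach x∈

  componentOf : ∀ u → ∃ λ S → IsComponent S × u ∈ S
  componentOf u = S , record
    { subgraph = induced-subgraph (subset-⊆ c₀) (u , u∈S) (λ c const x∈ y∈ →
        trans (≡-sym (fromBase c const x∈)) (fromBase c const y∈))
    ; closed = λ a∈ ad → in⁺ (saturated (in⁻ a∈) ad) } , u∈S
    where
    open Closure (closure u)
    c₀ = _∈ᵇ reached
    S  = subset c₀
    in⁺ : ∀ {x} → x ∈ reached → x ∈ S
    in⁺ = ∈-subset⁺ c₀ ∘ ∈⇒∈ᵇ
    in⁻ : ∀ {x} → x ∈ S → x ∈ reached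
    in⁻ = ∈ᵇ⇒∈ ∘ ∈-subset⁻ c₀
    u∈S = in⁺ base
    along : ∀ (c : Fin n → Bool) → (∀ {a b} → a ∈ S → b ∈ S → adj G a b ≡ true → c a ≡ c b) →
            ∀ {l x y} → x ∈ S → Walk l x y → c x ≡ c y
    along c const x∈ stay       = refl
    along c const x∈ (step e w) = let z∈ = in⁺ (saturated (in⁻ x∈) e) in trans (const x∈ z∈ e) (along c const z∈ w)
    fromBase : ∀ (c : Fin n → Bool) → (∀ {a b} → a ∈ S → b ∈ S → adj G a b ≡ true → c a ≡ c b) →
               ∀ {x} → x ∈ S → c u ≡ c x
    fromBase c const x∈ = along c const u∈S (proj₂ (reachable (in⁻ x∈)))

  -- Membership in a closed set `X` is constant along edges, by symmetry in both directions, so a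
  -- component that meets `X` lies inside it. Taking `X` to be the set reached from a vertex yields
  -- walks; taking it to be another component yields uniqueness.
  component-spread : ∀ {S} → IsComponent S → ∀ {X} → (∀ {a b} → a ∈ X → adj G a b ≡ true → b ∈ X) →
                     ∀ {u v} → u ∈ S → v ∈ S → u ∈ X → v ∈ X
  component-spread {S} C {X} sat u∈ v∈ u∈X = ∈ᵇ⇒∈ (subst T
    (cohesive (isConn (subgraph C)) (_∈ᵇ X) const u∈ v∈) (∈⇒∈ᵇ u∈X))
    where
    const : ∀ {a b} → (a , b) ∈ induced G S → a ∈ᵇ X ≡ b ∈ᵇ X
    const e = let ad = proj₁ (∈-edges⁻ G (proj₁ (∈-induced⁻ {S} e))) in
      T-⇔⇒≡ (λ a∈ → ∈⇒∈ᵇ (sat (∈ᵇ⇒∈ a∈) ad)) (λ b∈ → ∈⇒∈ᵇ (sat (∈ᵇ⇒∈ b∈) (adj-sym ad)))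

  component-geodesic : ∀ {S} → IsComponent S → ∀ {u v} → u ∈ S → v ∈ S → Geodesic u v
  component-geodesic C {u} u∈ v∈ = geodesic (proj₂ (reachable (component-spread C saturated u∈ v∈ base)))
    where open Closure (closure u)

  component-unique : ∀ {S S′} → IsComponent S → IsComponent S′ → ∀ {w} → w ∈ S → w ∈ S′ → S ≡ S′
  component-unique C C′ w∈ w∈′ = subset-ext (V⊆ (subgraph C)) (V⊆ (subgraph C′))
    (λ x∈ → component-spread C (closed C′) w∈ x∈ w∈′) (λ x∈ → component-spread C′ (closed C) w∈′ x∈ w∈)

  Unique-components : Unique components
  Unique-components = Unique-filter⁺ (T? ∘ isComponent G) (Unique-sublists (allFin⁺ n))

  Unique-component : ∀ {S} → S ∈ components → Unique S
  Unique-component S∈ = Unique-resp-⊆ (V⊆ (subgraph (∈-components⁻ S∈))) (allFin⁺ n)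

  -- Concatenated, the components list every vertex exactly once: `component-unique` excludes
  -- repetitions and `componentOf` omissions.
  sum-component-sizes : sum (map length components) ≡ n
  sum-component-sizes = begin
    sum (map length components)       ≡⟨ length-concatMap id components ⟨
    length (concatMap id components)  ≡⟨ ≤-antisym
        (Unique-length-≤ u (λ _ → ∈-allFin _))
        (Unique-length-≤ (allFin⁺ n) λ {v} _ → let S , C , v∈ = componentOf v in
           ∈-concatMap⁺ id (lose (∈-components⁺ C) v∈)) ⟩
    length (allFin n)                 ≡⟨ length-tabulate {n = n} id ⟩
    n                                 ∎
    where
    open ≡-Reasoning
    u : Unique (concatMap id components)
    u = Unique-concatMap Unique-components Unique-component
          λ S∈ S′∈ → component-unique (∈-components⁻ S∈) (∈-components⁻ S′∈)

  -- Pairs of vertices within a component, and the lower bound for `F`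

  componentPairs : List (Fin n × Fin n)
  componentPairs = concatMap pairs components

  length-componentPairs : length componentPairs ≡ sum (map (tri ∘ length) components)
  length-componentPairs = trans (length-concatMap pairs components) (go components)
    where
    go : ∀ Ss → sum (map (length ∘ pairs) Ss) ≡ sum (map (tri ∘ length) Ss)
    go []       = refl
    go (S ∷ Ss) = cong₂ _+_ (length-pairs S) (go Ss)

  Unique-componentPairs : Unique componentPairs
  Unique-componentPairs = Unique-concatMap Unique-components (Unique-pairs ∘ Unique-component)
    λ S∈ S′∈ p p′ → component-unique (∈-components⁻ S∈) (∈-components⁻ S′∈)
      (proj₁ (∈-pairs⁻ p)) (proj₁ (∈-pairs⁻ p′))

  Spans : Fin n × Fin n → List (Fin n) × List Edge → Set
  Spans (u , v) (V , E) = Σ (Geodesic u v) λ g → V ≡ vertices g × E ≡ induced G V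

  spans-total : ∀ {e} → e ∈ componentPairs → ∃ λ H → H ∈ subgraphs G × Spans e H
  spans-total e∈ with find (∈-concatMap⁻ pairs {xs = components} e∈)
  ... | S , S∈ , e∈S = _ , ∈-subgraphs⁺ G (geodesic-subgraph g) , g , refl , refl
    where g = component-geodesic (∈-components⁻ S∈) (proj₁ (∈-pairs⁻ e∈S)) (proj₂ (∈-pairs⁻ e∈S))

  componentPairs-ordered : ∀ {u v} → (u , v) ∈ componentPairs → toℕ u ≤ toℕ v
  componentPairs-ordered e∈ with find (∈-concatMap⁻ pairs {xs = components} e∈)
  ... | S , S∈ , e∈S = [ ≤-reflexive ∘ cong toℕ , <⇒≤ ]′
          (pairs-ordered (sorted (V⊆ (subgraph (∈-components⁻ S∈)))) e∈S)

  spans-injective : ∀ {e e′ H} → e ∈ componentPairs → e′ ∈ componentPairs → Spans e H → Spans e′ H → e ≡ e′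
  spans-injective {u , v} {u′ , v′} e∈ e′∈ (g , refl , _) (g′ , eq , _)
    with extremes g g′ (len-≤ g′ g (subst (u ∈_) eq (start∈ g)) (subst (v ∈_) eq (end∈ g)))
                       (subst (u′ ∈_) (≡-sym eq) (start∈ g′)) (subst (v′ ∈_) (≡-sym eq) (end∈ g′))
  ... | inj₁ (refl , refl) = refl
  -- The two pairs are reversals of each other, yet both have the smaller vertex in front; hence
  -- their entries coincide.
  ... | inj₂ (refl , refl) = cong₂ _,_ u≡v (≡-sym u≡v)
    where u≡v = toℕ-injective (≤-antisym (componentPairs-ordered e∈) (componentPairs-ordered e′∈))

  F-lower-bound : sum (map (tri ∘ length) components) ≤ F G
  F-lower-bound = subst₂ _≤_ length-componentPairs (length-subgraphs G)
    (length-injection Spans Unique-componentPairs spans-total spans-injective)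

  extremal-component : F G ≤ sum (map (tri ∘ length) components) → ∀ {S} → S ∈ components →
                       ∃₂ λ u v → Σ (Geodesic u v) λ g → S ≡ vertices g
  extremal-component le {S} S∈ =
    let (u , v) , _ , g , eq , _ = injection-onto Spans Unique-componentPairs spans-total spans-injective
          (subst₂ _≤_ (≡-sym (length-subgraphs G)) (≡-sym length-componentPairs) le)
          {S , induced G S} (∈-subgraphs⁺ G (subgraph (∈-components⁻ S∈)))
    in u , v , g , eq

-- Convexity of the triangular numbers

tri-+ : ∀ q d → tri (q + d) ≡ tri q + q * d + tri d
tri-+ q zero = trans (cong tri (+-identityʳ q))
  (solve 2 (λ t q → t := t :+ q :* con 0 :+ con 0) refl (tri q) q)
tri-+ q (suc d) = trans (cong tri (+-suc q d)) (trans (cong (suc (q + d) +_) (tri-+ q d))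
  (solve 4 (λ q d t s → con 1 :+ (q :+ d) :+ (t :+ q :* d :+ s)
                     := t :+ q :* (con 1 :+ d) :+ (con 1 :+ d :+ s)) refl q d (tri q) (tri d)))

tri-double : ∀ m → m * suc m ≡ tri m * 2
tri-double zero    = refl
tri-double (suc m) = trans (solve 1 (λ m → (con 1 :+ m) :* (con 2 :+ m) := m :* (con 1 :+ m) :+ (con 1 :+ m) :* con 2) refl m)
  (trans (cong (_+ suc m * 2) (tri-double m))
         (solve 2 (λ t m → t :* con 2 :+ (con 1 :+ m) :* con 2 := (con 1 :+ m :+ t) :* con 2) refl (tri m) m))

-- tri lies above its secant through q and q + 1, with excess e.
tri-secant : ∀ q m → ∃ λ e → tri m + q * suc q ≡ tri q + m * suc q + e × (e ≡ 0 → m ≡ q ⊎ m ≡ suc q)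
tri-secant q m with ≤-total q m
... | inj₁ q≤m with m ∸ q | m+[n∸m]≡n q≤m
...   | zero  | refl = 0 , trivial , λ _ → inj₁ (+-identityʳ q)
  where
  trivial : tri (q + 0) + q * suc q ≡ tri q + (q + 0) * suc q + 0
  trivial rewrite +-identityʳ q = ≡-sym (+-identityʳ _)
-- Here `m` is `q + 1 + d`, and the excess `tri d` vanishes only for `d = 0`, at the right end of
-- the secant.
...   | suc d | refl = tri d
        , trans (cong (_+ q * suc q) (tri-+ q (suc d)))
            (solve 4 (λ q d t s → t :+ q :* (con 1 :+ d) :+ (con 1 :+ d :+ s) :+ q :* (con 1 :+ q)
                               := t :+ (q :+ (con 1 :+ d)) :* (con 1 :+ q) :+ s) refl q d (tri q) (tri d))
        , λ e≡0 → inj₂ (trans (+-suc q d) (cong suc (trans (cong (q +_) (tri-zero d e≡0)) (+-identityʳ q))))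
  where
  tri-zero : ∀ d → tri d ≡ 0 → d ≡ 0
  tri-zero zero _ = refl
tri-secant q m | inj₂ m≤q with q ∸ m | m+[n∸m]≡n m≤q
...   | zero  | refl = 0 , trivial , λ _ → inj₁ (≡-sym (+-identityʳ m))
  where
  trivial : tri m + (m + 0) * suc (m + 0) ≡ tri (m + 0) + m * suc (m + 0) + 0
  trivial rewrite +-identityʳ m = ≡-sym (+-identityʳ _)
-- Here `q` is `m + 1 + d`; the excess is positive, so there is no case of equality below `q`.
...   | suc d | refl = tri (suc d)
        , trans (solve 3 (λ m d t → t :+ (m :+ (con 1 :+ d)) :* (con 1 :+ (m :+ (con 1 :+ d)))
                               := t :+ m :* (con 1 :+ d) :+ m :* (con 1 :+ (m :+ (con 1 :+ d)))
                                    :+ (con 1 :+ d) :* (con 2 :+ d)) refl m d (tri m))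
            (trans (cong (tri m + m * suc d + m * suc (m + suc d) +_) (tri-double (suc d)))
            (trans (solve 4 (λ a b c s → a :+ b :+ c :+ s :* con 2 := a :+ b :+ s :+ c :+ s) refl
                      (tri m) (m * suc d) (m * suc (m + suc d)) (tri (suc d)))
                   (cong (λ t → t + m * suc (m + suc d) + tri (suc d)) (≡-sym (tri-+ m (suc d))))))
        , λ ()

sum-tri-secant : ∀ q ms → ∃ λ e →
  sum (map tri ms) + length ms * (q * suc q) ≡ length ms * tri q + sum ms * suc q + e
  × (e ≡ 0 → All (λ m → m ≡ q ⊎ m ≡ suc q) ms)
sum-tri-secant q []       = 0 , refl , λ _ → []
sum-tri-secant q (m ∷ ms) with tri-secant q m | sum-tri-secant q ms
... | e₁ , eq₁ , z₁ | e₂ , eq₂ , z₂ = e₁ + e₂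
  , (begin
      tri m + sum (map tri ms) + (q * suc q + length ms * (q * suc q))
        ≡⟨ solve 4 (λ a b c d → a :+ b :+ (c :+ d) := (a :+ c) :+ (b :+ d)) refl
             (tri m) (sum (map tri ms)) (q * suc q) (length ms * (q * suc q)) ⟩
      (tri m + q * suc q) + (sum (map tri ms) + length ms * (q * suc q))
        ≡⟨ cong₂ _+_ eq₁ eq₂ ⟩
      tri q + m * suc q + e₁ + (length ms * tri q + sum ms * suc q + e₂)
        ≡⟨ solve 7 (λ t m q e l s f → t :+ m :* q :+ e :+ (l :* t :+ s :* q :+ f)
             := t :+ l :* t :+ (m :+ s) :* q :+ (e :+ f)) refl (tri q) m (suc q) e₁ (length ms) (sum ms) e₂ ⟩
      tri q + length ms * tri q + (m + sum ms) * suc q + (e₁ + e₂) ∎)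
  , λ z → z₁ (m+n≡0⇒m≡0 e₁ z) ∷ z₂ (m+n≡0⇒n≡0 e₁ z)
  where open ≡-Reasoning

-- The secant is affine in the size, so only the number of parts and their total enter. With total
-- `k * q + r` the terms `k * (q * suc q)` cancel, and the right-hand side of the theorem remains.
sum-tri-bound : ∀ {k} q r ms → length ms ≡ k → sum ms ≡ k * q + r → ∃ λ e →
  sum (map tri ms) ≡ r * suc q + k * tri q + e × (e ≡ 0 → All (λ m → m ≡ q ⊎ m ≡ suc q) ms)
sum-tri-bound {k} q r ms refl total with sum-tri-secant q ms
... | e , eq , z = e , +-cancelʳ-≡ (k * (q * suc q)) _ _ (trans eq (trans (cong (λ s → k * tri q + s * suc q + e) total)
    (solve 5 (λ k q r t e → k :* t :+ (k :* q :+ r) :* (con 1 :+ q) :+ e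
       := r :* (con 1 :+ q) :+ k :* t :+ e :+ k :* (q :* (con 1 :+ q))) refl k q r (tri q) e))) , z

-- The truncated division loses nothing, because `q * suc q` is twice a triangular number.
half-product : ∀ k q → (k * q * suc q) / 2 ≡ k * tri q
half-product k q = trans (cong (_/ 2) (trans (*-assoc k q (suc q)) (trans (cong (k *_) (tri-double q)) (≡-sym (*-assoc k (tri q) 2)))))
  (m*n/n≡m (k * tri q) 2)

-- Assembling an isomorphism from the components

-- An isomorphism from `H` onto the subgraph of `G` induced on the vertices satisfying `C`.
-- Describing the piece by a predicate allows pieces to be united without renumbering `G`.
record Model {n m} (G : Graph n) (C : Fin n → Set) (H : Graph m) : Set where
  field
    vertex    : Fin m → Fin n
    injective : ∀ {i j} → vertex i ≡ vertex j → i ≡ j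
    faithful  : ∀ i j → adj G (vertex i) (vertex j) ≡ adj H i j
    sound     : ∀ i → C (vertex i)
    onto      : ∀ {v} → C v → ∃ λ i → vertex i ≡ v
open Model

module _ {n : ℕ} {G : Graph n} where

  Separated : (C D : Fin n → Set) → Set
  Separated C D = ∀ {u v} → C u → D v → u ≢ v × adj G u v ≡ false

  model-size : ∀ {m S} {H : Graph m} → Unique S → Model G (_∈ S) H → length S ≡ m
  model-size {m} {S} uS M = trans (≤-antisym
      (Unique-length-≤ uS λ v∈ → let i , eq = onto M v∈ in subst (_∈ vs) eq (∈-map⁺ (vertex M) (∈-allFin i)))
      (Unique-length-≤ (Unique-map⁺ (injective M) (allFin⁺ m)) λ v∈ → let i , _ , eq = ∈-map⁻ (vertex M) v∈ in subst (_∈ S) (≡-sym eq) (sound M i)))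
    (trans (length-map (vertex M) (allFin m)) (length-tabulate {n = m} id))
    where vs = map (vertex M) (allFin m)

  model-≅ : ∀ {m C} {H : Graph m} → (∀ v → C v) → Model G C H → G ≅ H
  model-≅ {C = C} {H} all M = record
    { bij = mk↔ₛ′ index (vertex M) (λ i → injective M (section (vertex M i))) section
    ; preserve = λ u v → trans (cong₂ (adj G) (≡-sym (section u)) (≡-sym (section v))) (faithful M (index u) (index v)) }
    where
    index = λ v → proj₁ (onto M (all v))
    section : ∀ v → vertex M (index v) ≡ v
    section v = proj₂ (onto M (all v))

  model-resp : ∀ {m C D} {H : Graph m} → (∀ {v} → C v → D v) → (∀ {v} → D v → C v) → Model G C H → Model G D H
  model-resp to from M = record
    { vertex = vertex M ; injective = injective M ; faithful = faithful M
    ; sound = λ i → to (sound M i) ; onto = λ d → onto M (from d) }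

  -- Separation does double duty: disjointness keeps the joint map injective, and the absence of
  -- edges between the pieces matches the `false` entries of `unionAdj`.
  model-∪ : ∀ {m k C D} {H : Graph m} {K : Graph k} → Separated C D →
            Model G C H → Model G D K → Model G (λ v → C v ⊎ D v) (H ∪ K)
  model-∪ {m} {k} {C} {D} {H} {K} sep M N = record
    { vertex = vertex′ ∘ splitAt m
    ; injective = λ {i} {j} eq → trans (≡-sym (join-splitAt m k i))
        (trans (cong (join m k) (injective′ (splitAt m i) (splitAt m j) eq)) (join-splitAt m k j))
    ; faithful = λ i j → faithful′ (splitAt m i) (splitAt m j)
    ; sound = λ i → sound′ (splitAt m i)
    ; onto = onto′ }
    where
    vertex′ : Fin m ⊎ Fin k → Fin n
    vertex′ = [ vertex M , vertex N ]′
    injective′ : ∀ x y → vertex′ x ≡ vertex′ y → x ≡ y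
    injective′ (inj₁ i) (inj₁ j) eq = cong inj₁ (injective M eq)
    injective′ (inj₂ i) (inj₂ j) eq = cong inj₂ (injective N eq)
    injective′ (inj₁ i) (inj₂ j) eq = contradiction eq (proj₁ (sep (sound M i) (sound N j)))
    injective′ (inj₂ i) (inj₁ j) eq = contradiction (≡-sym eq) (proj₁ (sep (sound M j) (sound N i)))
    faithful′ : ∀ x y → adj G (vertex′ x) (vertex′ y) ≡ unionAdj H K x y
    faithful′ (inj₁ i) (inj₁ j) = faithful M i j
    faithful′ (inj₂ i) (inj₂ j) = faithful N i j
    faithful′ (inj₁ i) (inj₂ j) = proj₂ (sep (sound M i) (sound N j))
    faithful′ (inj₂ i) (inj₁ j) = trans (sym G _ _) (proj₂ (sep (sound M j) (sound N i)))
    sound′ : ∀ x → C (vertex′ x) ⊎ D (vertex′ x)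
    sound′ (inj₁ i) = inj₁ (sound M i)
    sound′ (inj₂ i) = inj₂ (sound N i)
    onto′ : ∀ {v} → C v ⊎ D v → ∃ λ i → vertex′ (splitAt m i) ≡ v
    onto′ (inj₁ c) = let i , eq = onto M c in i ↑ˡ k , trans (cong vertex′ (splitAt-↑ˡ m i k)) eq
    onto′ (inj₂ d) = let i , eq = onto N d in m ↑ʳ i , trans (cong vertex′ (splitAt-↑ʳ m k i)) eq

  model-copies : ∀ {m} {H : Graph m} {Ss} → AllPairs (λ S S′ → Separated (_∈ S) (_∈ S′)) Ss →
                 All (λ S → Model G (_∈ S) H) Ss → Model G (λ v → Any (v ∈_) Ss) (copies (length Ss) H)
  model-copies [] [] = record
    { vertex = λ () ; injective = λ { {()} } ; faithful = λ () ; sound = λ () ; onto = λ () }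
  model-copies (sep ∷ seps) (M ∷ Ms) = model-resp
    (λ { (inj₁ v∈) → here v∈ ; (inj₂ v∈) → there v∈ }) (λ { (here v∈) → inj₁ v∈ ; (there v∈) → inj₂ v∈ })
    (model-∪ (λ u∈ v∈ → let S′ , S′∈ , v∈′ = find v∈ in All.lookup sep S′∈ u∈ v∈′) M (model-copies seps Ms))

  -- A geodesic has no chords: an edge is a walk of length one, so by `separation` the positions of
  -- its ends differ by at most one.
  model-path : ∀ {u v} (g : Geodesic G u v) → Model G (_∈ vertices G g) (P (suc (Geodesic.len g)))
  model-path g = record
    { vertex    = at ∘ toℕ
    ; injective = λ {i} {j} eq → toℕ-injective (at-injective G g (bounded i) (bounded j) eq)
    ; faithful  = λ i j → T-⇔⇒≡ (consecutive i j) (edge i j)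
    ; sound     = λ i → ∈-vertices⁺ G g (bounded i)
    ; onto      = λ v∈ → let i , i≤l , eq = ∈-vertices⁻ G g v∈ in
                    fromℕ< (s≤s i≤l) , trans (cong at (toℕ-fromℕ< (s≤s i≤l))) (≡-sym eq) }
    where
    open Geodesic g
    bounded : (i : Fin (suc len)) → toℕ i ≤ len
    bounded i = ≤-pred (toℕ<n i)
    consecutive : ∀ i j → T (adj G (at (toℕ i)) (at (toℕ j))) →
                  T ((suc (toℕ i) ≡ᵇ toℕ j) ∨ (suc (toℕ j) ≡ᵇ toℕ i))
    consecutive i j t with <-cmp (toℕ i) (toℕ j)
    ... | tri< i<j _ _ = Equivalence.from T-∨ (inj₁ (≡⇒≡ᵇ _ _ (≤-antisym i<j (≤-trans
            (separation G g (bounded i) (bounded j) (step (Equivalence.to T-≡ t) stay)) (≤-reflexive (+-comm (toℕ i) 1))))))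
    ... | tri> _ _ j<i = Equivalence.from (T-∨ {suc (toℕ i) ≡ᵇ toℕ j}) (inj₂ (≡⇒≡ᵇ _ _ (≤-antisym j<i (≤-trans
            (separation G g (bounded j) (bounded i) (step (adj-sym G (Equivalence.to T-≡ t)) stay)) (≤-reflexive (+-comm (toℕ j) 1))))))
    ... | tri≈ _ i≡j _ = ⊥-elim (subst T (trans (cong (λ k → adj G (at (toℕ i)) (at k)) (≡-sym i≡j)) (irrefl G _)) t)
    edge : ∀ i j → T ((suc (toℕ i) ≡ᵇ toℕ j) ∨ (suc (toℕ j) ≡ᵇ toℕ i)) → T (adj G (at (toℕ i)) (at (toℕ j)))
    edge i j t with Equivalence.to (T-∨ {suc (toℕ i) ≡ᵇ toℕ j}) t
    ... | inj₁ e = Equivalence.from T-≡ (subst (λ k → adj G (at (toℕ i)) (at k) ≡ true) i+1≡j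
                     (adjacent (≤-trans (≤-reflexive i+1≡j) (bounded j))))
      where i+1≡j = ≡ᵇ⇒≡ (suc (toℕ i)) (toℕ j) e
    ... | inj₂ e = Equivalence.from T-≡ (adj-sym G (subst (λ k → adj G (at (toℕ j)) (at k) ≡ true) j+1≡i
                     (adjacent (≤-trans (≤-reflexive j+1≡i) (bounded i)))))
      where j+1≡i = ≡ᵇ⇒≡ (suc (toℕ j)) (toℕ i) e

sized : ∀ {A : Set} → ℕ → List (List A) → List (List A)
sized m = filter (λ S → length S ≟ m)

module _ {A : Set} (q : ℕ) where

  -- Every entry contributes `q` to the total and each long one contributes one more. The two
  -- equations determine both counts from the number of entries and the total.
  sized-counts : ∀ {Ss : List (List A)} → All (λ S → length S ≡ q ⊎ length S ≡ suc q) Ss →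
                 length (sized (suc q) Ss) + length (sized q Ss) ≡ length Ss
                 × length Ss * q + length (sized (suc q) Ss) ≡ sum (map length Ss)
  sized-counts [] = refl , refl
  sized-counts {S ∷ Ss} (inj₁ p ∷ ps)
    rewrite filter-reject (λ S → length S ≟ suc q) {S} {Ss} (λ p′ → 1+n≢n (trans (≡-sym p′) p))
          | filter-accept (λ S → length S ≟ q) {S} {Ss} p
    = let eq₁ , eq₂ = sized-counts ps in
      trans (+-suc _ _) (cong suc eq₁) , trans (+-assoc q _ _) (cong₂ _+_ (≡-sym p) eq₂)
  sized-counts {S ∷ Ss} (inj₂ p ∷ ps)
    rewrite filter-accept (λ S → length S ≟ suc q) {S} {Ss} p
          | filter-reject (λ S → length S ≟ q) {S} {Ss} (λ p′ → 1+n≢n (trans (≡-sym p) p′))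
    = let eq₁ , eq₂ = sized-counts ps in
      cong suc eq₁ , trans (+-suc _ _) (trans (cong suc (+-assoc q _ _)) (cong₂ _+_ (≡-sym p) eq₂))

AllPairs-map-∈ : ∀ {A : Set} {R Q : A → A → Set} {xs} → (∀ {x y} → x ∈ xs → y ∈ xs → R x y → Q x y) →
                 AllPairs R xs → AllPairs Q xs
AllPairs-map-∈ f []       = []
AllPairs-map-∈ f (r ∷ rs) = All.tabulate (λ y∈ → f (here refl) (there y∈) (All.lookup r y∈))
                          ∷ AllPairs-map-∈ (λ x∈ y∈ → f (there x∈) (there y∈)) rs

module _ {n : ℕ} {G : Graph n} where

  assemble : ∀ q {Ss} → AllPairs _≢_ Ss →
    (∀ {S S′} → S ∈ Ss → S′ ∈ Ss → S ≢ S′ → Separated {G = G} (_∈ S) (_∈ S′)) →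
    (∀ {S} → S ∈ Ss → Model G (_∈ S) (P (length S))) →
    (∀ {S} → S ∈ Ss → length S ≡ q ⊎ length S ≡ suc q) →
    (∀ v → ∃ λ S → S ∈ Ss × v ∈ S) →
    G ≅ (copies (length (sized (suc q) Ss)) (P (suc q)) ∪ copies (length (sized q Ss)) (P q))
  assemble q {Ss} distinct separated path size cover = model-≅ covered (model-∪ sep (block (suc q)) (block q))
    where
    sized⁻ : ∀ m {S} → S ∈ sized m Ss → S ∈ Ss × length S ≡ m
    sized⁻ m = ∈-filter⁻ (λ S → length S ≟ m) {xs = Ss}
    block : ∀ m → Model G (λ v → Any (v ∈_) (sized m Ss)) (copies (length (sized m Ss)) (P m))
    block m = model-copies
      (AllPairs-map-∈ (λ S∈ S′∈ → separated (proj₁ (sized⁻ m S∈)) (proj₁ (sized⁻ m S′∈)))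
        (AllPairs-filter⁺ (λ S → length S ≟ m) distinct))
      (All.tabulate λ {S} S∈ → let S∈′ , eq = sized⁻ m S∈ in subst (λ k → Model G (_∈ S) (P k)) eq (path S∈′))
    sep : Separated {G = G} (λ v → Any (v ∈_) (sized (suc q) Ss)) (λ v → Any (v ∈_) (sized q Ss))
    sep u∈ v∈ = let S , S∈ , u∈S = find u∈ ; S′ , S′∈ , v∈S′ = find v∈
                    S∈c , eq = sized⁻ (suc q) S∈ ; S′∈c , eq′ = sized⁻ q S′∈ in
      separated S∈c S′∈c (λ S≡S′ → 1+n≢n (trans (≡-sym eq) (trans (cong length S≡S′) eq′))) u∈S v∈S′
    covered : ∀ v → Any (v ∈_) (sized (suc q) Ss) ⊎ Any (v ∈_) (sized q Ss)
    covered v with cover v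
    ... | S , S∈ , v∈ with size S∈
    ...   | inj₁ eq = inj₂ (lose (∈-filter⁺ (λ S → length S ≟ q) S∈ eq) v∈)
    ...   | inj₂ eq = inj₁ (lose (∈-filter⁺ (λ S → length S ≟ suc q) S∈ eq) v∈)

module _ {n : ℕ} (G : Graph n) where

  components-separated : ∀ {S S′} → S ∈ components G → S′ ∈ components G → S ≢ S′ → Separated {G = G} (_∈ S) (_∈ S′)
  components-separated S∈ S′∈ S≢S′ {u} {v} u∈ v∈ =
    (λ { refl → S≢S′ (component-unique G C C′ u∈ v∈) }) , notAdjacent
    where
    C  = ∈-components⁻ G S∈
    C′ = ∈-components⁻ G S′∈
    notAdjacent : adj G u v ≡ false
    notAdjacent with adj G u v in ad
    ... | false = refl
    ... | true  = contradiction (component-unique G C C′ (closed C u∈ ad) v∈) S≢S′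

  extremal-≅ : ∀ q → F G ≤ sum (map (tri ∘ length) (components G)) →
    All (λ S → length S ≡ q ⊎ length S ≡ suc q) (components G) →
    G ≅ (copies (length (sized (suc q) (components G))) (P (suc q)) ∪ copies (length (sized q (components G))) (P q))
  extremal-≅ q le sizes = assemble q (Unique-components G) components-separated path (All.lookup sizes)
    λ v → let S , C , v∈ = componentOf G v in S , ∈-components⁺ G C , v∈
    where
    path : ∀ {S} → S ∈ components G → Model G (_∈ S) (P (length S))
    path {S} S∈ = let u , v , g , eq = extremal-component G le S∈
                      M = subst (λ X → Model G (_∈ X) (P (suc (Geodesic.len g)))) (≡-sym eq) (model-path g)
      -- The model has `suc len` vertices; `model-size` identifies this number with the size of the
      -- component.
      in subst (λ m → Model G (_∈ S) (P m)) (≡-sym (model-size (Unique-component G S∈) M)) M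

-- Connected subgraphs of linear forests

-- Grouped by right end: the group ending at `m` has `suc m` members, in step with the recursion of
-- `tri`.
intervals : ℕ → List (ℕ × ℕ)
intervals zero    = []
intervals (suc m) = map (_, m) (upTo (suc m)) ++ intervals m

length-intervals : ∀ m → length (intervals m) ≡ tri m
length-intervals zero    = refl
length-intervals (suc m) = trans (length-++ (map (_, m) (upTo (suc m))))
  (cong₂ _+_ (trans (length-map (_, m) (upTo (suc m))) (length-upTo (suc m))) (length-intervals m))

∈-intervals : ∀ {a b} m → a ≤ b → b < m → (a , b) ∈ intervals m
∈-intervals (suc m) a≤b (s≤s b≤m) with m≤n⇒m<n∨m≡n b≤m
... | inj₁ b<m  = ∈-++⁺ʳ (map (_, m) (upTo (suc m))) (∈-intervals m a≤b b<m)
... | inj₂ refl = ∈-++⁺ˡ (∈-map⁺ (_, m) (∈-upTo⁺ (s≤s a≤b)))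

-- Edges join consecutive numbers, but consecutive numbers may be unjoined where one path ends and
-- the next begins. `spans` must contain every unbroken interval, so its length serves as an upper
-- estimate.
record LinearForest {n} (H : Graph n) : Set where
  field
    linear : ∀ {i j} → adj H i j ≡ true → suc (toℕ i) ≡ toℕ j ⊎ suc (toℕ j) ≡ toℕ i
    spans  : List (ℕ × ℕ)
    covers : ∀ {a b} → a ≤ b → b < n →
             (∀ {i j} → a ≤ toℕ i → toℕ j ≤ b → suc (toℕ i) ≡ toℕ j → adj H i j ≡ true) →
             (a , b) ∈ spans
open LinearForest

path-forest : ∀ m → LinearForest (P m)
path-forest m = record
  { linear = λ {i} {j} ad → [ inj₁ ∘ ≡ᵇ⇒≡ _ _ , inj₂ ∘ ≡ᵇ⇒≡ _ _ ]′
      (Equivalence.to (T-∨ {suc (toℕ i) ≡ᵇ toℕ j}) (Equivalence.from T-≡ ad))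
  ; spans  = intervals m
  ; covers = λ a≤b b<m _ → ∈-intervals m a≤b b<m }

empty-forest : LinearForest empty
empty-forest = record { linear = λ { {()} } ; spans = [] ; covers = λ { _ () _ } }

∪-forest : ∀ {m k} {H : Graph m} {K : Graph k} → LinearForest H → LinearForest K → LinearForest (H ∪ K)
∪-forest {m} {k} {H} {K} LH LK = record
  { linear = λ {i} {j} ad → subst₂ (λ i j → suc (toℕ i) ≡ toℕ j ⊎ suc (toℕ j) ≡ toℕ i)
      (join-splitAt m k i) (join-splitAt m k j) (linear′ (splitAt m i) (splitAt m j) ad)
  ; spans  = spans LH ++ map shiftBy (spans LK)
  ; covers = covers′ }
  where
  shiftBy : ℕ × ℕ → ℕ × ℕ
  shiftBy (a , b) = m + a , m + b
  linear′ : ∀ x y → unionAdj H K x y ≡ true →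
            suc (toℕ (join m k x)) ≡ toℕ (join m k y) ⊎ suc (toℕ (join m k y)) ≡ toℕ (join m k x)
  linear′ (inj₁ i) (inj₁ j) ad rewrite toℕ-↑ˡ i k | toℕ-↑ˡ j k = linear LH ad
  linear′ (inj₂ i) (inj₂ j) ad rewrite toℕ-↑ʳ m i | toℕ-↑ʳ m j =
    [ (λ e → inj₁ (trans (≡-sym (+-suc m _)) (cong (m +_) e)))
    , (λ e → inj₂ (trans (≡-sym (+-suc m _)) (cong (m +_) e))) ]′ (linear LK ad)
  covers′ : ∀ {a b} → a ≤ b → b < m + k →
            (∀ {i j} → a ≤ toℕ i → toℕ j ≤ b → suc (toℕ i) ≡ toℕ j → adj (H ∪ K) i j ≡ true) →
            (a , b) ∈ spans LH ++ map shiftBy (spans LK)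
  covers′ {a} {b} a≤b b<m+k full with b <? m
  ... | yes b<m = ∈-++⁺ˡ (covers LH a≤b b<m λ {i} {j} a≤i j≤b e →
          subst₂ (λ x y → unionAdj H K x y ≡ true) (splitAt-↑ˡ m i k) (splitAt-↑ˡ m j k)
            (full (subst (a ≤_) (≡-sym (toℕ-↑ˡ i k)) a≤i) (subst (_≤ b) (≡-sym (toℕ-↑ˡ j k)) j≤b)
                  (trans (cong suc (toℕ-↑ˡ i k)) (trans e (≡-sym (toℕ-↑ˡ j k))))))
  ... | no b≮m with m ≤? a
  ...   | yes m≤a = ∈-++⁺ʳ (spans LH) (subst (_∈ map shiftBy (spans LK)) (cong₂ _,_ (m+[n∸m]≡n m≤a) (m+[n∸m]≡n m≤b))
            (∈-map⁺ shiftBy (covers LK (∸-monoˡ-≤ m a≤b)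
              (+-cancelˡ-< m _ _ (subst (_< m + k) (≡-sym (m+[n∸m]≡n m≤b)) b<m+k)) λ {i} {j} a≤i j≤b e →
                subst₂ (λ x y → unionAdj H K x y ≡ true) (splitAt-↑ʳ m k i) (splitAt-↑ʳ m k j)
                  (full (subst₂ _≤_ (m+[n∸m]≡n m≤a) (≡-sym (toℕ-↑ʳ m i)) (+-monoʳ-≤ m a≤i))
                        (subst₂ _≤_ (≡-sym (toℕ-↑ʳ m j)) (m+[n∸m]≡n m≤b) (+-monoʳ-≤ m j≤b))
                        (trans (cong suc (toℕ-↑ʳ m i)) (trans (≡-sym (+-suc m _)) (trans (cong (m +_) e) (≡-sym (toℕ-↑ʳ m j)))))))))
    where m≤b = ≮⇒≥ b≮m
  -- The interval straddles the border of the two blocks. Being unbroken it would need an edge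
  -- between the last vertex of `H`, numbered `m ∸ 1`, and the first of `K`, numbered `m`; the union
  -- has none.
  ...   | no m≰a = contradiction noEdge λ ()
    where
    m≤b = ≮⇒≥ b≮m
    a<m = ≰⇒> m≰a
    pred<m : m ∸ 1 < m
    pred<m = ∸-monoʳ-< {m} (s≤s z≤n) (≤-trans (s≤s z≤n) a<m)
    0<k : 0 < k
    0<k = +-cancelˡ-< m 0 k (subst (_< m + k) (≡-sym (+-identityʳ m)) (≤-<-trans m≤b b<m+k))
    i = fromℕ< pred<m ↑ˡ k
    j = m ↑ʳ fromℕ< 0<k
    toℕ-i : toℕ i ≡ m ∸ 1
    toℕ-i = trans (toℕ-↑ˡ _ k) (toℕ-fromℕ< pred<m)
    toℕ-j : toℕ j ≡ m
    toℕ-j = trans (toℕ-↑ʳ m _) (trans (cong (m +_) (toℕ-fromℕ< 0<k)) (+-identityʳ m))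
    noEdge : false ≡ true
    noEdge = subst₂ (λ x y → unionAdj H K x y ≡ true) (splitAt-↑ˡ m (fromℕ< pred<m) k) (splitAt-↑ʳ m k (fromℕ< 0<k))
      (full {i} {j} (≤-trans (∸-monoˡ-≤ 1 a<m) (≤-reflexive (≡-sym toℕ-i))) (≤-trans (≤-reflexive toℕ-j) m≤b)
        (trans (cong suc toℕ-i) (trans (m+[n∸m]≡n (≤-trans (s≤s z≤n) a<m)) (≡-sym toℕ-j))))

copies-forest : ∀ {m} {H : Graph m} c → LinearForest H → LinearForest (copies c H)
copies-forest zero    L = empty-forest
copies-forest (suc c) L = ∪-forest L (copies-forest c L)

length-∪-spans : ∀ {m k} {H : Graph m} {K : Graph k} (L : LinearForest H) (L′ : LinearForest K) →
                 length (spans (∪-forest L L′)) ≡ length (spans L) + length (spans L′)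
length-∪-spans L L′ = trans (length-++ (spans L)) (cong (length (spans L) +_) (length-map _ (spans L′)))

length-copies-spans : ∀ {m} {H : Graph m} c (L : LinearForest H) →
                      length (spans (copies-forest c L)) ≡ c * length (spans L)
length-copies-spans zero    L = refl
length-copies-spans (suc c) L = trans (length-∪-spans L (copies-forest c L)) (cong (length (spans L) +_) (length-copies-spans c L))

extremum : ∀ {A : Set} {_⊑_ : A → A → Set} → (∀ {x y z} → x ⊑ y → y ⊑ z → x ⊑ z) → (∀ x y → x ⊑ y ⊎ y ⊑ x) →
           ∀ {x} xs → x ∈ xs → ∃ λ y → y ∈ xs × (∀ {z} → z ∈ xs → y ⊑ z)
extremum {_⊑_ = _⊑_} tr tot (x ∷ xs) _ = go x xs
  where
  reflexive : ∀ x → x ⊑ x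
  reflexive x = [ id , id ]′ (tot x x)
  go : ∀ x xs → ∃ λ y → y ∈ x ∷ xs × (∀ {z} → z ∈ x ∷ xs → y ⊑ z)
  go x []        = x , here refl , λ { (here refl) → reflexive x }
  go x (x′ ∷ xs) with go x′ xs
  ... | y , y∈ , least with tot x y
  ...   | inj₁ x⊑y = x , here refl , λ { (here refl) → reflexive x ; (there z∈) → tr x⊑y (least z∈) }
  ...   | inj₂ y⊑x = y , there y∈ , λ { (here refl) → y⊑x ; (there z∈) → least z∈ }

-- Locates the edge crossing a threshold cut: of two consecutive numbers only `c` and `c + 1` lie on
-- different sides of `c`.
straddle : ∀ {p q c} → suc p ≡ q → (p ≤ᵇ c) ≢ (q ≤ᵇ c) → p ≡ c
straddle {p} {q} {c} s differ with <-cmp p c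
... | tri≈ _ eq _  = eq
... | tri< p<c _ _ = contradiction (T-⇔⇒≡ (λ _ → ≤⇒≤ᵇ (≤-trans (≤-reflexive (≡-sym s)) p<c)) (λ _ → ≤⇒≤ᵇ (<⇒≤ p<c))) differ
... | tri> _ _ c<p = contradiction (T-⇔⇒≡ (λ t → contradiction (≤ᵇ⇒≤ p c t) (<⇒≱ c<p))
        (λ t → contradiction (≤-trans (≤-trans (n≤1+n p) (≤-reflexive s)) (≤ᵇ⇒≤ q c t)) (<⇒≱ c<p))) differ

module _ {n m : ℕ} (G : Graph n) (H : Graph m) (G≅H : G ≅ H) (L : LinearForest H) where
  open _≅_ G≅H

  position : Fin n → Fin m
  position = Inverse.to bij

  -- The isomorphism enters only through this numbering. The subgraphs of `G` are counted in place,
  -- without transporting them to `H`.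
  label : Fin n → ℕ
  label = toℕ ∘ position

  label-injective : ∀ {x y} → label x ≡ label y → x ≡ y
  label-injective {x} {y} eq = trans (≡-sym (Inverse.strictlyInverseʳ bij x))
    (trans (cong (Inverse.from bij) (toℕ-injective eq)) (Inverse.strictlyInverseʳ bij y))

  label-linear : ∀ {x y} → adj G x y ≡ true → suc (label x) ≡ label y ⊎ suc (label y) ≡ label x
  label-linear {x} {y} ad = linear L (trans (≡-sym (preserve x y)) ad)

  HasSpan : List (Fin n) × List (Edge {n}) → ℕ × ℕ → Set
  HasSpan (V , E) (a , b) = (∃ λ x → x ∈ V × label x ≡ a) × (∃ λ y → y ∈ V × label y ≡ b)
                          × (∀ {z} → z ∈ V → a ≤ label z × label z ≤ b)

  module _ {V E} (sub : IsConnectedSubgraph G V E) where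

    -- The vertices of V labelled at most c form a cut, which an edge of E must cross.
    link : ∀ {a b} → HasSpan (V , E) (a , b) → ∀ {c} → a ≤ c → c < b →
           ∃₂ λ x y → label x ≡ c × label y ≡ suc c × ((x , y) ∈ E ⊎ (y , x) ∈ E)
    link ((x₀ , x₀∈ , refl) , (y₀ , y₀∈ , refl) , _) {c} a≤c c<b
      with Any.any? (λ e → ¬? ((label (proj₁ e) ≤ᵇ c) ≟ᵇ (label (proj₂ e) ≤ᵇ c))) E
    ... | no ¬cut = ⊥-elim (<⇒≱ c<b (≤ᵇ⇒≤ _ _ (subst T
            (cohesive (isConn sub) (λ z → label z ≤ᵇ c) uncut x₀∈ y₀∈) (≤⇒≤ᵇ a≤c))))
      where
      uncut : ∀ {x y} → (x , y) ∈ E → (label x ≤ᵇ c) ≡ (label y ≤ᵇ c)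
      uncut {x} {y} e∈ with (label x ≤ᵇ c) ≟ᵇ (label y ≤ᵇ c)
      ... | yes eq = eq
      ... | no neq = contradiction (lose e∈ neq) ¬cut
    ... | yes cut with find cut
    ...   | (x , y) , e∈ , differ with label-linear (proj₁ (∈-edges⁻ G (⊆-lookup (E⊆ sub) e∈)))
    ...     | inj₁ s = x , y , lx , trans (≡-sym s) (cong suc lx) , inj₁ e∈
      where lx = straddle s differ
    ...     | inj₂ s = y , x , ly , trans (≡-sym s) (cong suc ly) , inj₂ e∈
      where ly = straddle s (differ ∘ ≡-sym)

    -- The top label `b` is attained by the definition of a span. Any smaller label of the interval
    -- is the lower end of the edge that `link` finds crossing the cut just above it.
    occupied : ∀ {a b} → HasSpan (V , E) (a , b) → ∀ {z} → a ≤ label z → label z ≤ b → z ∈ V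
    occupied h@(_ , (y₀ , y₀∈ , ly₀) , _) {z} a≤z z≤b with m≤n⇒m<n∨m≡n z≤b
    ... | inj₂ z≡b = subst (_∈ V) (label-injective (trans ly₀ (≡-sym z≡b))) y₀∈
    ... | inj₁ z<b with link h a≤z z<b
    ...   | x , y , lx , _ , e = subst (_∈ V) (label-injective lx)
            ([ proj₁ ∘ endpoints sub , proj₂ ∘ endpoints sub ]′ e)

    -- An edge of `G` joins consecutive labels, and `link` at the lower one gives an edge of `E`
    -- with the same labels. As labels are injective, it has the same ends.
    allEdges : ∀ {a b} → HasSpan (V , E) (a , b) → ∀ {x y} → (x , y) ∈ edges G →
               a ≤ label x × label x ≤ b → a ≤ label y × label y ≤ b → (x , y) ∈ E
    allEdges h {x} {y} e∈ (a≤x , x≤b) (a≤y , y≤b) with label-linear (proj₁ (∈-edges⁻ G e∈))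
    ... | inj₁ s = fromLink (link h a≤x (≤-trans (≤-reflexive s) y≤b))
      where
      fromLink : _ → (x , y) ∈ E
      fromLink (x′ , y′ , lx , ly , e) with label-injective lx | label-injective (trans ly s)
      -- The edge of `E` cannot be the reversed pair, since `edges` lists each edge with its smaller
      -- vertex first.
      ... | refl | refl = [ id , (λ e′ → contradiction (proj₂ (∈-edges⁻ G e∈)) (<⇒≯ (proj₂ (∈-edges⁻ G (⊆-lookup (E⊆ sub) e′))))) ]′ e
    ... | inj₂ s = fromLink (link h a≤y (≤-trans (≤-reflexive s) x≤b))
      where
      fromLink : _ → (x , y) ∈ E
      fromLink (y′ , x′ , ly , lx , e) with label-injective ly | label-injective (trans lx s)
      ... | refl | refl = [ (λ e′ → contradiction (proj₂ (∈-edges⁻ G e∈)) (<⇒≯ (proj₂ (∈-edges⁻ G (⊆-lookup (E⊆ sub) e′))))) , id ]′ e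

    span-exists : ∃ λ ab → ab ∈ spans L × HasSpan (V , E) ab
    span-exists with extremum {_⊑_ = λ x y → label x ≤ label y} ≤-trans (λ x y → ≤-total (label x) (label y)) V (proj₂ (nonempty (isConn sub)))
                   | extremum {_⊑_ = λ x y → label y ≤ label x} (λ p q → ≤-trans q p) (λ x y → ≤-total (label y) (label x)) V (proj₂ (nonempty (isConn sub)))
    ... | x₀ , x₀∈ , lo | y₀ , y₀∈ , hi = (label x₀ , label y₀) , covers L (lo y₀∈) (toℕ<n _) full , h
      where
      h : HasSpan (V , E) (label x₀ , label y₀)
      h = (x₀ , x₀∈ , refl) , (y₀ , y₀∈ , refl) , λ z∈ → lo z∈ , hi z∈
      full : ∀ {i j} → label x₀ ≤ toℕ i → toℕ j ≤ label y₀ → suc (toℕ i) ≡ toℕ j → adj H i j ≡ true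
      -- Each step of the interval is realised by the edge of `E` crossing the cut there, so the
      -- interval is unbroken in `H`.
      full {i} {j} a≤i j≤b s = let x , y , lx , ly , e = link h a≤i (≤-trans (≤-reflexive s) j≤b) in
        trans (cong₂ (adj H) (≡-sym (toℕ-injective lx)) (≡-sym (toℕ-injective (trans ly s))))
          (trans (≡-sym (preserve x y)) ([ isEdge , adj-sym G ∘ isEdge ]′ e))
        where
        isEdge : ∀ {x y} → (x , y) ∈ E → adj G x y ≡ true
        isEdge e∈ = proj₁ (∈-edges⁻ G (⊆-lookup (E⊆ sub) e∈))

  span-injective : ∀ {V E V′ E′ ab} → IsConnectedSubgraph G V E → IsConnectedSubgraph G V′ E′ →
                   HasSpan (V , E) ab → HasSpan (V′ , E′) ab → (V , E) ≡ (V′ , E′)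
  span-injective s s′ h h′ = cong₂ _,_
    (subset-ext (V⊆ s) (V⊆ s′) (λ z∈ → V-within s s′ h h′ z∈) (λ z∈ → V-within s′ s h′ h z∈))
    (⊆-extensional (Unique-edges G) (E⊆ s) (E⊆ s′) (λ e∈ → E-within s s′ h h′ e∈) (λ e∈ → E-within s′ s h′ h e∈))
    where
    V-within : ∀ {V E V′ E′ ab} → IsConnectedSubgraph G V E → IsConnectedSubgraph G V′ E′ →
               HasSpan (V , E) ab → HasSpan (V′ , E′) ab → ∀ {z} → z ∈ V → z ∈ V′
    V-within s s′ (_ , _ , within) h′ z∈ = occupied s′ h′ (proj₁ (within z∈)) (proj₂ (within z∈))
    E-within : ∀ {V E V′ E′ ab} → IsConnectedSubgraph G V E → IsConnectedSubgraph G V′ E′ →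
               HasSpan (V , E) ab → HasSpan (V′ , E′) ab → ∀ {e} → e ∈ E → e ∈ E′
    E-within s s′ (_ , _ , within) h′ e∈ =
      allEdges s′ h′ (⊆-lookup (E⊆ s) e∈) (within (proj₁ (endpoints s e∈))) (within (proj₂ (endpoints s e∈)))

  F-upper-bound : F G ≤ length (spans L)
  F-upper-bound = subst (_≤ length (spans L)) (length-subgraphs G)
    (length-injection HasSpan (Unique-subgraphs G) (λ H∈ → span-exists (∈-subgraphs⁻ G H∈))
      λ H∈ H′∈ → span-injective (∈-subgraphs⁻ G H∈) (∈-subgraphs⁻ G H′∈))

-- The target forest and the proof of the theorem

target-forest : ∀ r q s → LinearForest (copies r (P (suc q)) ∪ copies s (P q))
target-forest r q s = ∪-forest (copies-forest r (path-forest (suc q))) (copies-forest s (path-forest q))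

length-target-spans : ∀ {k} r q → r ≤ k → length (spans (target-forest r q (k ∸ r))) ≡ r * suc q + k * tri q
length-target-spans {k} r q r≤k = begin
  length (spans (target-forest r q (k ∸ r)))
    ≡⟨ length-∪-spans (copies-forest r (path-forest (suc q))) (copies-forest (k ∸ r) (path-forest q)) ⟩
  length (spans (copies-forest r (path-forest (suc q)))) + length (spans (copies-forest (k ∸ r) (path-forest q)))
    ≡⟨ cong₂ _+_ (length-copies-spans r (path-forest (suc q))) (length-copies-spans (k ∸ r) (path-forest q)) ⟩
  r * length (intervals (suc q)) + (k ∸ r) * length (intervals q)
    ≡⟨ cong₂ (λ x y → r * x + (k ∸ r) * y) (length-intervals (suc q)) (length-intervals q) ⟩
  r * (suc q + tri q) + (k ∸ r) * tri q
    ≡⟨ solve 4 (λ r d q t → r :* (q :+ t) :+ d :* t := r :* q :+ (r :+ d) :* t) refl r (k ∸ r) (suc q) (tri q) ⟩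
  r * suc q + (r + (k ∸ r)) * tri q
    ≡⟨ cong (λ x → r * suc q + x * tri q) (m+[n∸m]≡n r≤k) ⟩
  r * suc q + k * tri q ∎
  where open ≡-Reasoning

theorem2p5 : (n k q r : ℕ) → 1 ≤ k → k ≤ n → n ≡ k * q + r → r < k →
    (G : Graph n) → numComponents G ≡ k →
    (r * suc q + (k * q * suc q) / 2 ≤ F G)
    × ((F G ≡ r * suc q + (k * q * suc q) / 2)
    ⇔ (G ≅ (copies r (P (suc q)) ∪ copies (k ∸ r) (P q))))
theorem2p5 n k q r _ _ n≡ r<k G comps rewrite half-product k q = lower , mk⇔ extremal attained
  where
  sizes = map length (components G)
  sum-sizes : sum sizes ≡ k * q + r
  sum-sizes = trans (sum-component-sizes G) n≡
  bound = sum-tri-bound q r sizes (trans (length-map length (components G)) comps) sum-sizes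
  -- The total excess of the component sizes over the secant through `q` and `suc q`.
  e = proj₁ bound
  sum-tri : sum (map (tri ∘ length) (components G)) ≡ r * suc q + k * tri q + e
  sum-tri = trans (cong sum (map-∘ (components G))) (proj₁ (proj₂ bound))
  lower : r * suc q + k * tri q ≤ F G
  lower = ≤-trans (m≤m+n _ e) (≤-trans (≤-reflexive (≡-sym sum-tri)) (F-lower-bound G))
  attained : G ≅ (copies r (P (suc q)) ∪ copies (k ∸ r) (P q)) → F G ≡ r * suc q + k * tri q
  attained iso = ≤-antisym (subst (F G ≤_) (length-target-spans r q (<⇒≤ r<k))
    (F-upper-bound G _ iso (target-forest r q (k ∸ r)))) lower
  extremal : F G ≡ r * suc q + k * tri q → G ≅ (copies r (P (suc q)) ∪ copies (k ∸ r) (P q))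
  extremal eq = subst₂ (λ a b → G ≅ (copies a (P (suc q)) ∪ copies b (P q))) long≡ short≡
    (extremal-≅ G q (≤-trans (≤-reflexive eq) (≤-trans (m≤m+n _ e) (≤-reflexive (≡-sym sum-tri)))) balanced)
    where
    -- `F G` is at least the bound plus `e`, so equality with the bound leaves nothing for `e`.
    e≡0 : e ≡ 0
    e≡0 = n≤0⇒n≡0 (+-cancelˡ-≤ (r * suc q + k * tri q) e 0 (≤-trans (≤-reflexive (≡-sym sum-tri))
            (≤-trans (F-lower-bound G) (≤-reflexive (trans eq (≡-sym (+-identityʳ _)))))))
    balanced : All (λ S → length S ≡ q ⊎ length S ≡ suc q) (components G)
    balanced = All-map⁻ (proj₂ (proj₂ bound) e≡0)
    counts = sized-counts q balanced
    -- With `k` components of size at least `q`, the surplus of `n` over `k * q` is both the number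
    -- of long components and `r`.
    long≡ : length (sized (suc q) (components G)) ≡ r
    long≡ = +-cancelˡ-≡ (k * q) _ _ (trans (cong (λ c → c * q + length (sized (suc q) (components G))) (≡-sym comps))
              (trans (proj₂ counts) sum-sizes))
    short≡ : length (sized q (components G)) ≡ k ∸ r
    short≡ = trans (≡-sym (m+n∸m≡n r _)) (cong (_∸ r) (trans (cong (_+ length (sized q (components G))) (≡-sym long≡))
               (trans (proj₁ counts) comps)))
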